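{- For $R=\mathbb{Z}_9$ and for $R=\mathbb{S}_3=\mathbb{F}_3[X]/(X^2)$ we have $\mathrm{m}_7(R)\le 62$; that is, there is no projective $(63,7)$-arc in $\mathrm{PHG}(2,R)$.
   Context: For a finite chain ring $R$ of length $2$ with residue field $\mathbb{F}_q$, the projective Hjelmslev plane $\mathrm{PHG}(2,R)$ is the incidence structure whose points are the free rank-$1$ submodules of the right module $R_R^3$, whose lines are the free rank-$2$ submodules of $R_R^3$, with incidence given by inclusion. A projective $(k,n)$-arc is a set of $k$ points meeting every line in at most $n$ points. For $0\le n\le q^2+q$, $\mathrm{m}_n(R)$ denotes the largest $k$ such that a projective $(k,n)$-arc exists in $\mathrm{PHG}(2,R)$. -}

module Defs where

open import Algebra.Bundles using (Ring)
open import Algebra.Module.Bundles using (RightModule)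
import Algebra.Module.Construct.DirectProduct as DirectProduct
import Algebra.Module.Construct.Idealization as Idealization
import Algebra.Module.Construct.TensorUnit as TensorUnit
import Algebra.Properties.Monoid.Sum as Sum
open import Algebra.Structures using (IsRing)
open import Data.Fin.Base using (Fin; toℕ)
open import Data.Fin.Properties using (toℕ-injective; toℕ-fromℕ<; toℕ<n; toℕ≤n)
open import Data.Fin.Subset using (Subset; _∈_; ∣_∣)
open import Data.Nat.Base as ℕ using (ℕ; _≤_; NonZero)
open import Data.Nat.DivMod using (_%_; _mod_; m%n<n; m<n⇒m%n≡m; n%n≡0; %-distribˡ-+; %-distribˡ-*)
open import Data.Nat.Properties as ℕ using (m∸n+n≡m)
open import Data.Product.Base using (∃; _,_)
open import Data.Vec.Functional using (Vector)
open import Function.Definitions using (Injective)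
open import Level using (Level; 0ℓ; _⊔_) renaming (suc to lsuc)
open import Relation.Binary.Core using (Rel)
open import Relation.Binary.PropositionalEquality
open import Relation.Unary as U using (Pred; _≐_)

private
  variable
    r ℓr m ℓm : Level

module Modular (n : ℕ) .{{_ : NonZero n}} where

  infixl 6 _⊕_
  infixl 7 _⊗_

  _⊕_ _⊗_ : Fin n → Fin n → Fin n
  a ⊕ b = (toℕ a ℕ.+ toℕ b) mod n
  a ⊗ b = (toℕ a ℕ.* toℕ b) mod n

  ⊖_ : Fin n → Fin n
  ⊖ a = (n ℕ.∸ toℕ a) mod n

  private
    ⟦_⟧ : ℕ → Fin n
    ⟦ k ⟧ = k mod n

    toℕ-mod : ∀ k → toℕ ⟦ k ⟧ ≡ k % n
    toℕ-mod k = toℕ-fromℕ< (m%n<n k n)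

    mod-cong : ∀ {j k} → j % n ≡ k % n → ⟦ j ⟧ ≡ ⟦ k ⟧
    mod-cong {j} {k} eq = toℕ-injective (trans (toℕ-mod j) (trans eq (sym (toℕ-mod k))))

    mod-toℕ : ∀ a → ⟦ toℕ a ⟧ ≡ a
    mod-toℕ a = toℕ-injective (trans (toℕ-mod (toℕ a)) (m<n⇒m%n≡m (toℕ<n a)))

    mod-+ : ∀ j k → ⟦ j ⟧ ⊕ ⟦ k ⟧ ≡ ⟦ j ℕ.+ k ⟧
    mod-+ j k = mod-cong (trans
      (cong₂ (λ x y → (x ℕ.+ y) % n) (toℕ-mod j) (toℕ-mod k))
      (sym (%-distribˡ-+ j k n)))

    mod-* : ∀ j k → ⟦ j ⟧ ⊗ ⟦ k ⟧ ≡ ⟦ j ℕ.* k ⟧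
    mod-* j k = mod-cong (trans
      (cong₂ (λ x y → (x ℕ.* y) % n) (toℕ-mod j) (toℕ-mod k))
      (sym (%-distribˡ-* j k n)))

    mod-+ˡ : ∀ j b → ⟦ j ⟧ ⊕ b ≡ ⟦ j ℕ.+ toℕ b ⟧
    mod-+ˡ j b = trans (cong (⟦ j ⟧ ⊕_) (sym (mod-toℕ b))) (mod-+ j (toℕ b))

    mod-+ʳ : ∀ a k → a ⊕ ⟦ k ⟧ ≡ ⟦ toℕ a ℕ.+ k ⟧
    mod-+ʳ a k = trans (cong (_⊕ ⟦ k ⟧) (sym (mod-toℕ a))) (mod-+ (toℕ a) k)

    mod-*ˡ : ∀ j b → ⟦ j ⟧ ⊗ b ≡ ⟦ j ℕ.* toℕ b ⟧
    mod-*ˡ j b = trans (cong (⟦ j ⟧ ⊗_) (sym (mod-toℕ b))) (mod-* j (toℕ b))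

    mod-*ʳ : ∀ a k → a ⊗ ⟦ k ⟧ ≡ ⟦ toℕ a ℕ.* k ⟧
    mod-*ʳ a k = trans (cong (_⊗ ⟦ k ⟧) (sym (mod-toℕ a))) (mod-* (toℕ a) k)

    via : ∀ {j k : ℕ} → j ≡ k → ⟦ j ⟧ ≡ ⟦ k ⟧
    via = cong ⟦_⟧

    ⊕-comm : ∀ a b → a ⊕ b ≡ b ⊕ a
    ⊕-comm a b = via (ℕ.+-comm (toℕ a) (toℕ b))

    ⊗-comm : ∀ a b → a ⊗ b ≡ b ⊗ a
    ⊗-comm a b = via (ℕ.*-comm (toℕ a) (toℕ b))

    ⊕-assoc : ∀ a b c → (a ⊕ b) ⊕ c ≡ a ⊕ (b ⊕ c)
    ⊕-assoc a b c = trans (mod-+ˡ _ c) (trans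
      (via (ℕ.+-assoc (toℕ a) (toℕ b) (toℕ c))) (sym (mod-+ʳ a _)))

    ⊗-assoc : ∀ a b c → (a ⊗ b) ⊗ c ≡ a ⊗ (b ⊗ c)
    ⊗-assoc a b c = trans (mod-*ˡ _ c) (trans
      (via (ℕ.*-assoc (toℕ a) (toℕ b) (toℕ c))) (sym (mod-*ʳ a _)))

    ⊗-distribˡ : ∀ a b c → a ⊗ (b ⊕ c) ≡ (a ⊗ b) ⊕ (a ⊗ c)
    ⊗-distribˡ a b c = trans (mod-*ʳ a _) (trans
      (via (ℕ.*-distribˡ-+ (toℕ a) (toℕ b) (toℕ c))) (sym (mod-+ _ _)))

    ⊗-distribʳ : ∀ a b c → (b ⊕ c) ⊗ a ≡ (b ⊗ a) ⊕ (c ⊗ a)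
    ⊗-distribʳ a b c = trans (⊗-comm (b ⊕ c) a)
      (trans (⊗-distribˡ a b c) (cong₂ _⊕_ (⊗-comm a b) (⊗-comm a c)))

    ⊕-identityˡ : ∀ a → ⟦ 0 ⟧ ⊕ a ≡ a
    ⊕-identityˡ a = trans (mod-+ˡ 0 a) (mod-toℕ a)

    ⊗-identityˡ : ∀ a → ⟦ 1 ⟧ ⊗ a ≡ a
    ⊗-identityˡ a = trans (mod-*ˡ 1 a) (trans (via (ℕ.*-identityˡ (toℕ a))) (mod-toℕ a))

    ⊖-inverseˡ : ∀ a → (⊖ a) ⊕ a ≡ ⟦ 0 ⟧
    ⊖-inverseˡ a = trans (mod-+ˡ _ a) (trans (via (m∸n+n≡m (toℕ≤n a)))
      (mod-cong (trans (n%n≡0 n) (sym (m<n⇒m%n≡m (ℕ.>-nonZero⁻¹ n))))))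

    isRing : IsRing _≡_ _⊕_ _⊗_ ⊖_ (0 mod n) (1 mod n)
    isRing = record
      { +-isAbelianGroup = record
        { isGroup = record
          { isMonoid = record
            { isSemigroup = record
              { isMagma = record { isEquivalence = isEquivalence ; ∙-cong = cong₂ _⊕_ }
              ; assoc = ⊕-assoc
              }
            ; identity = ⊕-identityˡ , λ a → trans (⊕-comm a _) (⊕-identityˡ a)
            }
          ; inverse = ⊖-inverseˡ , λ a → trans (⊕-comm a _) (⊖-inverseˡ a)
          ; ⁻¹-cong = cong ⊖_
          }
        ; comm = ⊕-comm
        }
      ; *-cong = cong₂ _⊗_
      ; *-assoc = ⊗-assoc
      ; *-identity = ⊗-identityˡ , λ a → trans (⊗-comm a _) (⊗-identityˡ a)
      ; distrib = ⊗-distribˡ , ⊗-distribʳ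
      }

  ring : Ring 0ℓ 0ℓ
  ring = record { isRing = isRing }

ℤ/_ : (n : ℕ) .{{_ : NonZero n}} → Ring 0ℓ 0ℓ
ℤ/ n = Modular.ring n

-- The pair (a , b) stands for the class of a + bX, so that
-- (a , b) * (c , d) = (a * c , a * d + b * c).
_[X]/⟨X²⟩ : Ring r ℓr → Ring r ℓr
R [X]/⟨X²⟩ = Idealization.ringᴺ R TensorUnit.bimodule

ℤ₉ : Ring 0ℓ 0ℓ
ℤ₉ = ℤ/ 9

𝕊₃ : Ring 0ℓ 0ℓ
𝕊₃ = (ℤ/ 3) [X]/⟨X²⟩

module _ {R : Ring r ℓr} (M : RightModule R m ℓm) where

  open Ring R using (Carrier; _≈_; 0#)
  open RightModule M
  open Sum +ᴹ-monoid using (sum)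

  record Submodule : Set (r ⊔ lsuc m ⊔ ℓm) where
    field
      member     : Pred Carrierᴹ m
      member-≈   : ∀ {x y} → x ≈ᴹ y → member x → member y
      0-closed   : member 0ᴹ
      +-closed   : ∀ {x y} → member x → member y → member (x +ᴹ y)
      *ᵣ-closed  : ∀ {x} c → member x → member (x *ᵣ c)

  combination : ∀ {k} → Vector Carrierᴹ k → Vector Carrier k → Carrierᴹ
  combination b c = sum (λ i → b i *ᵣ c i)

  LinearlyIndependent : ∀ {k} → Vector Carrierᴹ k → Set (r ⊔ ℓr ⊔ ℓm)
  LinearlyIndependent b = ∀ c → combination b c ≈ᴹ 0ᴹ → ∀ i → c i ≈ 0#

  record IsBasis {k} (N : Submodule) (b : Vector Carrierᴹ k) : Set (r ⊔ ℓr ⊔ m ⊔ ℓm) where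
    open Submodule N
    field
      members     : ∀ i → member (b i)
      independent : LinearlyIndependent b
      spanning    : ∀ {x} → member x → ∃ λ c → x ≈ᴹ combination b c

  FreeOfRank : ℕ → Submodule → Set (r ⊔ ℓr ⊔ m ⊔ ℓm)
  FreeOfRank k N = ∃ λ (b : Vector Carrierᴹ k) → IsBasis N b

-- The plane PHG(2,R); the construction makes sense for every ring R.
module PHG₂ (R : Ring r ℓr) where

  R³ : RightModule R r ℓr
  R³ = DirectProduct.rightModule R¹ (DirectProduct.rightModule R¹ R¹)
    where R¹ = TensorUnit.rightModule

  Point Line : Set (lsuc r ⊔ ℓr)
  Point = ∃ (FreeOfRank R³ 1)
  Line  = ∃ (FreeOfRank R³ 2)

  -- Points are submodules, so equality of points ignores the chosen basis.
  _≈ᴾ_ : Rel Point r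
  (P , _) ≈ᴾ (Q , _) = Submodule.member P ≐ Submodule.member Q

  _∈ᴸ_ : Point → Line → Set r
  (P , _) ∈ᴸ (L , _) = Submodule.member P U.⊆ Submodule.member L

  -- A set of k points is an enumeration without repetition; it meets the line
  -- L in at most n points if every subset of it lying on L has at most n elements.
  record ProjectiveArc (k n : ℕ) : Set (lsuc r ⊔ ℓr) where
    field
      point    : Fin k → Point
      distinct : Injective _≡_ _≈ᴾ_ point
      meets    : ∀ (L : Line) (S : Subset k) → (∀ {i} → i ∈ S → point i ∈ᴸ L) → ∣ S ∣ ≤ n

open PHG₂ public using (ProjectiveArc)

-- `m[ n , R ]≡ k` says that mₙ(R) = k.
record m[_,_]≡_ (n : ℕ) (R : Ring r ℓr) (k : ℕ) : Set (lsuc r ⊔ ℓr) where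
  field
    attained : ProjectiveArc R k n
    largest  : ∀ j → ProjectiveArc R j n → j ≤ k

{-# OPTIONS --safe #-}
module Submission where

-- The 117 points fall into 13 neighbour classes of 9, which are the points of PG(2,3);
-- lines likewise.  A class carries the affine plane AG(2,3): the 9 lines of a line class ℓ
-- cut a class x on ℓ in the 3 rows of one parallel class, each row three times, and two
-- rows in different classes on ℓ lie on exactly one common line of ℓ.  Let u x be the number
-- of arc points in x, S ℓ the sum of u over ℓ, and f the number of arc points in a row
-- (x , ℓ , j).  Adding up the three lines through a row gives 3 f + S ℓ ≤ u x + 21.  Summing
-- this over the four rows through an arc point of x gives u x ≤ 6, with equality only if
-- every nonempty row of x is tight; then x lies on three lines with S = 21 and on one with
-- S = 18, on which it has an empty row.  A line with S = 21 has types 6, 6, 6, 3, and a line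
-- with S = 18 cannot carry two sixes, since the line through their two empty rows would meet
-- the arc in a negative number of points.  Hence a six forces exactly seven sixes, lying on
-- seven lines with S = 21 and on seven others with S = 18, but there are only 13 lines.  So
-- u ≤ 5, and as the total is 63, some u x is 5 and all S are at least 18.  This makes every
-- nonempty row of x a pair, which is absurd because 5 is odd.

open import Defs
open import Algebra.Bundles using (Ring)
open import Algebra.Module.Bundles using (RightModule)
open import Data.Bool.Base using (true; false; if_then_else_)
open import Data.Empty using (⊥; ⊥-elim)
open import Data.Fin.Base using (Fin; suc; combine; remQuot; splitAt; _↑ˡ_; _↑ʳ_)
open import Data.Fin.Patterns
open import Data.Fin.Properties using (_≟_; all?; any?; remQuot-combine; ↑ˡ-injective)
open import Data.Fin.Subset using (∣_∣; _∈_)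
open import Data.Nat using (_≤_)
open import Data.Nat.Base using (ℕ; zero; suc; _+_; _*_; _∸_; _<_; z≤n; s≤s)
open import Data.Nat.Divisibility using (_∣_; _∣?_; ∣m+n∣m⇒∣n; ∣m∣n⇒∣m+n; m∣m*n; divides)
import Data.Nat.Properties as ℕ
open import Data.Nat.Tactic.RingSolver using (solve-∀)
open import Data.Product using (_×_)
open import Data.Product.Base using (∃; ∃₂; _,_; proj₁; proj₂; uncurry)
open import Data.Product.Relation.Binary.Pointwise.NonDependent using (×-decidable)
open import Data.Sum.Base using (_⊎_; inj₁; inj₂; [_,_]′)
open import Data.Vec.Base using (tabulate)
import Data.Vec.Functional as Vector
open import Data.Vec.Properties using (lookup∘tabulate; []=⇒lookup)
open import Function.Base using (_∘_; id)
open import Level using (Level; 0ℓ)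
open import Relation.Binary.Definitions using (Decidable)
open import Relation.Binary.PropositionalEquality using (_≡_; _≢_; refl; sym; trans; cong; cong₂; subst; subst₂; module ≡-Reasoning)
import Relation.Binary.Reasoning.Setoid as SetoidReasoning
open import Relation.Nullary using (¬_; Dec; does; yes; no; contradiction)
open import Relation.Nullary.Decidable using (True; toWitness; dec-true; dec-false; from-no; ¬?; _×-dec_; _→-dec_)
open import Algebra.Properties.Semiring.Sum ℕ.+-*-semiring using (sum; sum-syntax; sum-cong-≗; sum-replicate-zero; ∑-comm; ∑-distrib-+; *-distribˡ-sum; *-distribʳ-sum)

private variable
  p q : Level
  m n : ℕ

-- Indicators and finite sums

𝟙 : {P : Set p} → Dec P → ℕ
𝟙 P? = if does P? then 1 else 0

δ : Fin n → Fin n → ℕ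
δ i j = 𝟙 (i ≟ j)

𝟙-true : {P : Set p} (P? : Dec P) → P → 𝟙 P? ≡ 1
𝟙-true P? holds rewrite dec-true P? holds = refl

𝟙-false : {P : Set p} (P? : Dec P) → ¬ P → 𝟙 P? ≡ 0
𝟙-false P? fails rewrite dec-false P? fails = refl

𝟙-binary : {P : Set p} (P? : Dec P) → 𝟙 P? ≡ 0 ⊎ 𝟙 P? ≡ 1
𝟙-binary (yes _) = inj₂ refl
𝟙-binary (no _)  = inj₁ refl

𝟙-positive : {P : Set p} (P? : Dec P) → 0 < 𝟙 P? → P
𝟙-positive (yes holds) _ = holds

δ-refl : (i : Fin n) → δ i i ≡ 1
δ-refl i = 𝟙-true (i ≟ i) refl

∑-mono-≤ : {f g : Fin n → ℕ} → (∀ i → f i ≤ g i) → sum f ≤ sum g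
∑-mono-≤ {zero}  f≤g = z≤n
∑-mono-≤ {suc n} f≤g = ℕ.+-mono-≤ (f≤g 0F) (∑-mono-≤ (f≤g ∘ suc))

+-exchange : ∀ a b c → a + (b + c) ≡ b + (a + c)
+-exchange = solve-∀

-- No single gap `g i - f i` exceeds the sum of all gaps; the additive form avoids truncated
-- subtraction.
∑-slack : {f g : Fin n → ℕ} → (∀ i → f i ≤ g i) → ∀ i → g i + sum f ≤ f i + sum g
∑-slack {suc n} {f} {g} f≤g 0F = begin
  g 0F + (f 0F + sum (f ∘ suc)) ≡⟨ +-exchange (g 0F) (f 0F) _ ⟩
  f 0F + (g 0F + sum (f ∘ suc)) ≤⟨ ℕ.+-monoʳ-≤ (f 0F) (ℕ.+-monoʳ-≤ (g 0F) (∑-mono-≤ (f≤g ∘ suc))) ⟩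
  f 0F + (g 0F + sum (g ∘ suc)) ∎
  where open ℕ.≤-Reasoning
∑-slack {suc n} {f} {g} f≤g (suc i) = begin
  g (suc i) + (f 0F + sum (f ∘ suc)) ≡⟨ +-exchange (g (suc i)) (f 0F) _ ⟩
  f 0F + (g (suc i) + sum (f ∘ suc)) ≤⟨ ℕ.+-mono-≤ (f≤g 0F) (∑-slack (f≤g ∘ suc) i) ⟩
  g 0F + (f (suc i) + sum (g ∘ suc)) ≡⟨ +-exchange (g 0F) (f (suc i)) _ ⟩
  f (suc i) + (g 0F + sum (g ∘ suc)) ∎
  where open ℕ.≤-Reasoning

∑-positive : (f : Fin n → ℕ) → 0 < sum f → ∃ λ i → 0 < f i
∑-positive {suc n} f 0<∑ with f 0F in eq
... | suc _ = 0F , subst (0 <_) (sym eq) (s≤s z≤n)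
... | zero  = let i , 0<fi = ∑-positive (f ∘ suc) 0<∑ in suc i , 0<fi

∑-const-0 : {f : Fin n → ℕ} → (∀ i → f i ≡ 0) → sum f ≡ 0
∑-const-0 {n} f≡0 = trans (sum-cong-≗ f≡0) (sum-replicate-zero n)

∑-select : (f : Fin n → ℕ) (i : Fin n) → ∑[ j < n ] (f j * δ i j) ≡ f i
∑-select {suc n} f 0F =
  trans (cong₂ _+_ (ℕ.*-identityʳ _) (∑-const-0 λ j → ℕ.*-zeroʳ (f (suc j)))) (ℕ.+-identityʳ _)
∑-select {suc n} f (suc i) =
  trans (cong (_+ sum (λ j → f (suc j) * δ i j)) (ℕ.*-zeroʳ (f 0F))) (∑-select (f ∘ suc) i)

∑-swap : (c : Fin m → ℕ) (g : Fin m → Fin n → ℕ) →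
  ∑[ k < m ] (c k * ∑[ i < n ] g k i) ≡ ∑[ i < n ] ∑[ k < m ] (c k * g k i)
∑-swap c g = trans (sum-cong-≗ λ k → *-distribˡ-sum (c k) (g k)) (∑-comm λ k i → c k * g k i)

∑-linear : ∀ a b (f g : Fin n → ℕ) → ∑[ i < n ] (a * f i + b * g i) ≡ a * sum f + b * sum g
∑-linear a b f g = trans (∑-distrib-+ (λ i → a * f i) (λ i → b * g i))
  (sym (cong₂ _+_ (*-distribˡ-sum a f) (*-distribˡ-sum b g)))

∑-scale : ∀ a (f : Fin n → ℕ) → ∑[ i < n ] (a * f i) ≡ a * sum f
∑-scale a f = sym (*-distribˡ-sum a f)

∑-const : ∀ n c → ∑[ _ < n ] c ≡ n * c
∑-const zero    c = refl
∑-const (suc n) c = cong (c +_) (∑-const n c)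

∑-↑ˡ : ∀ k m (g : Fin (k + m) → ℕ) → ∑[ i < k ] g (i ↑ˡ m) ≤ sum g
∑-↑ˡ zero    m g = z≤n
∑-↑ˡ (suc k) m g = ℕ.+-monoʳ-≤ (g 0F) (∑-↑ˡ k m (g ∘ suc))

-- Turns the `Subset` cardinality in the definition of an arc into a sum that can be double counted.
∣tabulate∣ : {P : Fin n → Set p} (P? : ∀ i → Dec (P i)) → ∣ tabulate (does ∘ P?) ∣ ≡ sum (λ i → 𝟙 (P? i))
∣tabulate∣ {n = zero}  P? = refl
∣tabulate∣ {n = suc n} P? with does (P? 0F)
... | true  = cong suc (∣tabulate∣ (P? ∘ suc))
... | false = ∣tabulate∣ (P? ∘ suc)

∈-tabulate : {P : Fin n → Set p} (P? : ∀ i → Dec (P i)) → ∀ {i} → i ∈ tabulate (does ∘ P?) → P i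
∈-tabulate P? {i} i∈ with P? i | trans (sym (lookup∘tabulate (does ∘ P?) i)) ([]=⇒lookup i∈)
... | yes holds | _  = holds

𝟙-× : {P : Set p} {Q : Set q} (P? : Dec P) (Q? : Dec Q) → 𝟙 (P? ×-dec Q?) ≡ 𝟙 P? * 𝟙 Q?
𝟙-× (yes _) (yes _) = refl
𝟙-× (yes _) (no _)  = refl
𝟙-× (no _)  _       = refl

-- Point counts in the three rows of a class

multiple-of-3 : ∀ {S} → 18 ≤ S → S ≤ 21 → 3 ∣ S → S ≡ 18 ⊎ S ≡ 21
multiple-of-3 {S} 18≤S S≤21 3∣S with ℕ.m≤n⇒m<n∨m≡n 18≤S
... | inj₂ eq = inj₁ (sym eq)
... | inj₁ 19≤S with ℕ.m≤n⇒m<n∨m≡n 19≤S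
... | inj₂ refl = contradiction 3∣S (from-no (3 ∣? 19))
... | inj₁ 20≤S with ℕ.m≤n⇒m<n∨m≡n 20≤S
... | inj₂ refl = contradiction 3∣S (from-no (3 ∣? 20))
... | inj₁ 21≤S = inj₂ (ℕ.≤-antisym S≤21 21≤S)

-- Three tight rows add up to `18 + 3 * S ≡ 81`. Otherwise some row is empty and, the total being
-- positive, another one is tight, which makes `S` a multiple of 3.
six-rows : ∀ {S} (r : Fin 3 → ℕ) → 18 ≤ S → S ≤ 21 →
  (∀ j → r j ≡ 0 ⊎ 3 * r j + S ≡ 27) → ∑[ j < 3 ] r j ≡ 6 →
  S ≡ 21 ⊎ (S ≡ 18 × ∃ λ j → r j ≡ 0)
six-rows {S} r 18≤S S≤21 tight total = by-rows (tight 0F) (tight 1F) (tight 2F)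
  where
  open ≡-Reasoning
  Tight : Fin 3 → Set
  Tight j = 3 * r j + S ≡ 27
  collect : ∀ a b c S → 3 * (a + (b + (c + 0))) + 3 * S ≡ (3 * a + S) + ((3 * b + S) + (3 * c + S))
  collect = solve-∀
  zero-row : ∀ i {j} → r i ≡ 0 → Tight j → S ≡ 21 ⊎ (S ≡ 18 × ∃ λ j → r j ≡ 0)
  zero-row i {j} ri≡0 t
    with multiple-of-3 18≤S S≤21 (∣m+n∣m⇒∣n (subst (3 ∣_) (sym t) (divides 9 refl)) (m∣m*n (r j)))
  ... | inj₁ S≡18 = inj₂ (S≡18 , i , ri≡0)
  ... | inj₂ S≡21 = inj₁ S≡21
  by-rows : r 0F ≡ 0 ⊎ Tight 0F → r 1F ≡ 0 ⊎ Tight 1F → r 2F ≡ 0 ⊎ Tight 2F →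
    S ≡ 21 ⊎ (S ≡ 18 × ∃ λ j → r j ≡ 0)
  by-rows (inj₁ r₀) (inj₁ r₁) (inj₁ r₂) =
    contradiction (trans (sym total) (cong₂ _+_ r₀ (cong₂ _+_ r₁ (cong (_+ 0) r₂)))) λ ()
  by-rows (inj₁ r₀) (inj₁ _)  (inj₂ t)  = zero-row 0F r₀ t
  by-rows (inj₁ r₀) (inj₂ t)  _         = zero-row 0F r₀ t
  by-rows (inj₂ t)  (inj₁ r₁) _         = zero-row 1F r₁ t
  by-rows (inj₂ t)  (inj₂ _)  (inj₁ r₂) = zero-row 2F r₂ t
  by-rows (inj₂ t₀) (inj₂ t₁) (inj₂ t₂) = inj₁ (ℕ.*-cancelˡ-≡ S 21 3 (ℕ.+-cancelˡ-≡ 18 (3 * S) 63 (begin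
    18 + 3 * S                                          ≡⟨ cong (λ t → 3 * t + 3 * S) total ⟨
    3 * (r 0F + (r 1F + (r 2F + 0))) + 3 * S            ≡⟨ collect (r 0F) (r 1F) (r 2F) S ⟩
    (3 * r 0F + S) + ((3 * r 1F + S) + (3 * r 2F + S))  ≡⟨ cong₂ _+_ t₀ (cong₂ _+_ t₁ t₂) ⟩
    81                                                  ∎)))

-- No summand exceeds a third of the total, so all bounds are equalities. On a line class with
-- `S ℓ ≡ 21` this makes `u x` a multiple of 3.
thirds : ∀ {t} (r : Fin 3 → ℕ) → (∀ j → 3 * r j ≤ t) → ∑[ j < 3 ] r j ≡ t → t ≡ 3 * r 0F
thirds {t} r bound total = ℕ.≤-antisym (ℕ.+-cancelʳ-≤ (t + t) t (3 * r 0F) (begin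
  t + (t + t)                             ≡⟨ triple t ⟩
  3 * t                                   ≡⟨ cong (3 *_) total ⟨
  3 * (r 0F + (r 1F + (r 2F + 0)))        ≡⟨ collect (r 0F) (r 1F) (r 2F) ⟩
  3 * r 0F + (3 * r 1F + 3 * r 2F)        ≤⟨ ℕ.+-monoʳ-≤ (3 * r 0F) (ℕ.+-mono-≤ (bound 1F) (bound 2F)) ⟩
  3 * r 0F + (t + t)                      ∎)) (bound 0F)
  where
  open ℕ.≤-Reasoning
  triple : ∀ t → t + (t + t) ≡ 3 * t
  triple = solve-∀
  collect : ∀ a b c → 3 * (a + (b + (c + 0))) ≡ 3 * a + (3 * b + 3 * c)
  collect = solve-∀

five-rows : (r : Fin 3 → ℕ) → (∀ j → r j ≡ 0 ⊎ r j ≡ 2) → ¬ (∑[ j < 3 ] r j ≡ 5)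
five-rows r even total = from-no (2 ∣? 5) (subst (2 ∣_) total
  (∣m∣n⇒∣m+n (two∣ 0F) (∣m∣n⇒∣m+n (two∣ 1F) (∣m∣n⇒∣m+n (two∣ 2F) (divides 0 refl)))))
  where
  two∣ : ∀ j → 2 ∣ r j
  two∣ j with even j
  ... | inj₁ eq = divides 0 eq
  ... | inj₂ eq = divides 1 eq

-- Arc points in neighbour classes

F₃ : Set
F₃ = Fin 3

binary-mono : ∀ {c a b} → c ≡ 0 ⊎ c ≡ 1 → (c ≡ 1 → a ≤ b) → c * a ≤ c * b
binary-mono     (inj₁ refl) a≤b = z≤n
binary-mono {c} (inj₂ c≡1)  a≤b = ℕ.*-monoʳ-≤ c (a≤b c≡1)

binary-cong : ∀ {c a b} → c ≡ 0 ⊎ c ≡ 1 → (c ≡ 1 → a ≡ b) → c * a ≡ c * b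
binary-cong     (inj₁ refl) a≡b = refl
binary-cong {c} (inj₂ c≡1)  a≡b = cong (c *_) (a≡b c≡1)

-- I ℓ x is 1 if the class x lies on the line class ℓ, and 0 otherwise.  The point t of x
-- lies on the line s of ℓ if I ℓ x = 1 and slot ℓ x s = row ℓ x t.  The number v of classes
-- is a variable only to keep sums over the classes from unfolding.
record HjelmslevPlane (v : ℕ) : Set where
  field
    classes       : v ≡ 13
    I             : Fin v → Fin v → ℕ
    slot          : Fin v → Fin v → Fin 9 → F₃
    row           : Fin v → Fin v → Fin 9 → F₃
    I-binary      : ∀ ℓ x → I ℓ x ≡ 0 ⊎ I ℓ x ≡ 1
    line-size     : ∀ ℓ → ∑[ x < v ] I ℓ x ≡ 4
    joining-lines : ∀ x y → ∑[ ℓ < v ] (I ℓ x * I ℓ y) ≡ 1 + 3 * δ x y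
    slot-size     : ∀ ℓ x → I ℓ x ≡ 1 → ∀ j → ∑[ s < 9 ] δ (slot ℓ x s) j ≡ 3
    -- For `y` different from `x`, two rows share exactly one line of `ℓ`. For `y` equal to `x` they
    -- share three lines or none, according as they agree or not; the term `δ y x` on the left
    -- avoids subtraction.
    slots-meet    : ∀ ℓ x → I ℓ x ≡ 1 → ∀ y → I ℓ y ≡ 1 → ∀ j k →
      ∑[ s < 9 ] (δ (slot ℓ x s) j * δ (slot ℓ y s) k) + δ y x ≡ 3 * (δ y x * δ k j) + 1
    -- Three lines go through each row and one through both, which leaves 9 - 3 - 3 + 1 lines.
    slots-avoid   : ∀ ℓ x → I ℓ x ≡ 1 → ∀ y → I ℓ y ≡ 1 → δ y x ≡ 0 → ∀ j k →
      ∑[ s < 9 ] ((1 ∸ δ (slot ℓ x s) j) * (1 ∸ δ (slot ℓ y s) k)) ≤ 4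
    -- The rows in the four directions make the class an affine plane of order 3: two distinct
    -- points share one row, and a point shares all four with itself.
    joining-rows  : ∀ x t t′ → ∑[ ℓ < v ] (I ℓ x * δ (row ℓ x t) (row ℓ x t′)) ≡ 1 + 3 * δ t t′

module _ {v} (plane : HjelmslevPlane v) where
  open HjelmslevPlane plane

  record Arc (k n : ℕ) : Set where
    field
      cls       : Fin k → Fin v
      pos       : Fin k → Fin 9
      injective : ∀ {i j} → cls i ≡ cls j → pos i ≡ pos j → i ≡ j
      meets     : ∀ ℓ s → ∑[ i < k ] (I ℓ (cls i) * δ (slot ℓ (cls i) s) (row ℓ (cls i) (pos i))) ≤ n

  weight : (Fin v → ℕ) → Fin v → ℕ
  weight a ℓ = ∑[ x < v ] (I ℓ x * a x)

  -- Every other class is joined to `x` by one line class, while `x` lies on all four of its pencil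
  -- and is counted three extra times.
  ∑-pencil : ∀ a x → ∑[ ℓ < v ] (I ℓ x * weight a ℓ) ≡ sum a + 3 * a x
  ∑-pencil a x = begin
    ∑[ ℓ < v ] (I ℓ x * weight a ℓ)                     ≡⟨ ∑-swap (λ ℓ → I ℓ x) (λ ℓ y → I ℓ y * a y) ⟩
    ∑[ y < v ] ∑[ ℓ < v ] (I ℓ x * (I ℓ y * a y))      ≡⟨ sum-cong-≗ pointwise ⟩
    ∑[ y < v ] (1 * a y + 3 * (a y * δ x y))            ≡⟨ ∑-linear 1 3 a (λ y → a y * δ x y) ⟩
    1 * sum a + 3 * ∑[ y < v ] (a y * δ x y)            ≡⟨ cong₂ _+_ (ℕ.*-identityˡ (sum a)) (cong (3 *_) (∑-select a x)) ⟩
    sum a + 3 * a x                                      ∎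
    where
    open ≡-Reasoning
    regroup : ∀ d b → (1 + 3 * d) * b ≡ 1 * b + 3 * (b * d)
    regroup = solve-∀
    pointwise : ∀ y → ∑[ ℓ < v ] (I ℓ x * (I ℓ y * a y)) ≡ 1 * a y + 3 * (a y * δ x y)
    pointwise y = begin
      ∑[ ℓ < v ] (I ℓ x * (I ℓ y * a y))  ≡⟨ sum-cong-≗ (λ ℓ → sym (ℕ.*-assoc (I ℓ x) (I ℓ y) (a y))) ⟩
      ∑[ ℓ < v ] (I ℓ x * I ℓ y * a y)    ≡⟨ *-distribʳ-sum (a y) (λ ℓ → I ℓ x * I ℓ y) ⟨
      ∑[ ℓ < v ] (I ℓ x * I ℓ y) * a y    ≡⟨ cong (_* a y) (joining-lines x y) ⟩
      (1 + 3 * δ x y) * a y                ≡⟨ regroup (δ x y) (a y) ⟩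
      1 * a y + 3 * (a y * δ x y)          ∎

  ∑-classes-const : ∀ c → ∑[ _ < v ] c ≡ 13 * c
  ∑-classes-const c = trans (∑-const v c) (cong (_* c) classes)

  pencil-size : ∀ x → ∑[ ℓ < v ] I ℓ x ≡ 4
  pencil-size x = begin
    ∑[ ℓ < v ] I ℓ x            ≡⟨ sum-cong-≗ (λ ℓ → square (I-binary ℓ x)) ⟩
    ∑[ ℓ < v ] (I ℓ x * I ℓ x)  ≡⟨ joining-lines x x ⟩
    1 + 3 * δ x x                ≡⟨ cong (λ d → 1 + 3 * d) (δ-refl x) ⟩
    4                            ∎
    where
    open ≡-Reasoning
    square : ∀ {c} → c ≡ 0 ⊎ c ≡ 1 → c ≡ c * c
    square (inj₁ refl) = refl
    square (inj₂ refl) = refl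

  ∑-pencil-const : ∀ c x → ∑[ ℓ < v ] (I ℓ x * c) ≡ 4 * c
  ∑-pencil-const c x = trans (sym (*-distribʳ-sum c (λ ℓ → I ℓ x))) (cong (_* c) (pencil-size x))

  -- This is `∑-slack` for the pencil of `x`: the factor `I k x` removes the other line classes, so
  -- the bound is required on the pencil alone.
  pencil-slack : ∀ x (a b : Fin v → ℕ) → (∀ ℓ → I ℓ x ≡ 1 → a ℓ ≤ b ℓ) →
    ∀ ℓ → I ℓ x ≡ 1 → b ℓ + ∑[ k < v ] (I k x * a k) ≤ a ℓ + ∑[ k < v ] (I k x * b k)
  pencil-slack x a b a≤b ℓ x∈ℓ = subst₂ (λ c d → c + A ≤ d + B) (scale (b ℓ)) (scale (a ℓ))
    (∑-slack (λ k → binary-mono (I-binary k x) (a≤b k)) ℓ)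
    where
    A = ∑[ k < v ] (I k x * a k)
    B = ∑[ k < v ] (I k x * b k)
    scale : ∀ c → I ℓ x * c ≡ c
    scale c = trans (cong (_* c) x∈ℓ) (ℕ.*-identityˡ c)

  -- The factor `I ℓ y` extends `slots-meet` to classes off `ℓ`, where both sides vanish, so that
  -- the identity can be summed over all arc points.
  slots-meet′ : ∀ ℓ x → I ℓ x ≡ 1 → ∀ y j k →
    ∑[ s < 9 ] (δ (slot ℓ x s) j * (I ℓ y * δ (slot ℓ y s) k)) + δ y x ≡ 3 * (δ y x * δ k j) + I ℓ y
  slots-meet′ ℓ x x∈ℓ y j k = by-cases (I-binary ℓ y) (y ≟ x)
    where
    Goal : ℕ → Set
    Goal c = ∑[ s < 9 ] (δ (slot ℓ x s) j * (c * δ (slot ℓ y s) k)) + δ y x ≡ 3 * (δ y x * δ k j) + c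
    by-cases : I ℓ y ≡ 0 ⊎ I ℓ y ≡ 1 → Dec (y ≡ x) → Goal (I ℓ y)
    by-cases (inj₂ y∈ℓ) _ = subst Goal (sym y∈ℓ) (trans
      (cong (_+ δ y x) (sum-cong-≗ λ s → cong (δ (slot ℓ x s) j *_) (ℕ.*-identityˡ (δ (slot ℓ y s) k))))
      (slots-meet ℓ x x∈ℓ y y∈ℓ j k))
    by-cases (inj₁ y∉ℓ) (yes refl) = contradiction (trans (sym y∉ℓ) x∈ℓ) λ ()
    by-cases (inj₁ y∉ℓ) (no y≢x) = subst Goal (sym y∉ℓ) (trans
      (cong₂ _+_ (∑-const-0 λ s → ℕ.*-zeroʳ (δ (slot ℓ x s) j)) (𝟙-false (y ≟ x) y≢x))
      (cong (λ d → 3 * (d * δ k j) + 0) (sym (𝟙-false (y ≟ x) y≢x))))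

  -- Double counting for an arc with at most seven points on a line

  module _ {k} (arc : Arc k 7) where
    open Arc arc

    u : Fin v → ℕ
    u x = ∑[ i < k ] δ (cls i) x

    S : Fin v → ℕ
    S = weight u

    inRow : Fin v → Fin v → F₃ → Fin k → ℕ
    inRow ℓ x j i = δ (cls i) x * δ (row ℓ (cls i) (pos i)) j

    f : Fin v → Fin v → F₃ → ℕ
    f ℓ x j = sum (inRow ℓ x j)

    -- The indicator of line `s` of the line class `ℓ` on the arc points; `K ℓ s` is then the number
    -- of arc points on that line.
    on : Fin v → Fin 9 → Fin k → ℕ
    on ℓ s i = I ℓ (cls i) * δ (slot ℓ (cls i) s) (row ℓ (cls i) (pos i))

    K : Fin v → Fin 9 → ℕ
    K ℓ s = sum (on ℓ s)

    ∑-classes : ∀ a → ∑[ x < v ] (a x * u x) ≡ ∑[ i < k ] a (cls i)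
    ∑-classes a = trans (∑-swap a (λ x i → δ (cls i) x)) (sum-cong-≗ λ i → ∑-select a (cls i))

    ∑-rows : ∀ ℓ x → ∑[ j < 3 ] f ℓ x j ≡ u x
    ∑-rows ℓ x = trans (∑-comm (inRow ℓ x))
      (sum-cong-≗ λ i → ∑-select (λ _ → δ (cls i) x) (row ℓ (cls i) (pos i)))

    -- Of the three lines through row `j`, a point of that row lies on all, any other point of `x`
    -- on none, and a point of a different class on `ℓ` on exactly one.
    ∑-slot : ∀ ℓ x → I ℓ x ≡ 1 → ∀ j → ∑[ s < 9 ] (δ (slot ℓ x s) j * K ℓ s) + u x ≡ 3 * f ℓ x j + S ℓ
    ∑-slot ℓ x x∈ℓ j = begin
      ∑[ s < 9 ] (δ (slot ℓ x s) j * K ℓ s) + u x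
        ≡⟨ cong (_+ u x) (∑-swap (λ s → δ (slot ℓ x s) j) (on ℓ)) ⟩
      ∑[ i < k ] ∑[ s < 9 ] (δ (slot ℓ x s) j * on ℓ s i) + u x
        ≡⟨ ∑-distrib-+ _ (λ i → δ (cls i) x) ⟨
      ∑[ i < k ] (∑[ s < 9 ] (δ (slot ℓ x s) j * on ℓ s i) + δ (cls i) x)
        ≡⟨ sum-cong-≗ (λ i → slots-meet′ ℓ x x∈ℓ (cls i) j (row ℓ (cls i) (pos i))) ⟩
      ∑[ i < k ] (3 * inRow ℓ x j i + I ℓ (cls i))
        ≡⟨ ∑-distrib-+ _ (λ i → I ℓ (cls i)) ⟩
      ∑[ i < k ] (3 * inRow ℓ x j i) + ∑[ i < k ] I ℓ (cls i)
        ≡⟨ cong₂ _+_ (∑-scale 3 (inRow ℓ x j)) (sym (∑-classes (I ℓ))) ⟩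
      3 * f ℓ x j + S ℓ ∎
      where open ≡-Reasoning

    -- Each point of a class on `ℓ` lies on three of the nine lines of `ℓ`.
    ∑-line-class : ∀ ℓ → ∑[ s < 9 ] K ℓ s ≡ 3 * S ℓ
    ∑-line-class ℓ = begin
      ∑[ s < 9 ] K ℓ s
        ≡⟨ ∑-comm (on ℓ) ⟩
      ∑[ i < k ] ∑[ s < 9 ] on ℓ s i
        ≡⟨ sum-cong-≗ (λ i → ∑-scale (I ℓ (cls i)) (λ s → δ (slot ℓ (cls i) s) (row ℓ (cls i) (pos i)))) ⟩
      ∑[ i < k ] (I ℓ (cls i) * ∑[ s < 9 ] δ (slot ℓ (cls i) s) (row ℓ (cls i) (pos i)))
        ≡⟨ sum-cong-≗ (λ i → binary-cong (I-binary ℓ (cls i)) λ x∈ℓ → slot-size ℓ (cls i) x∈ℓ (row ℓ (cls i) (pos i))) ⟩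
      ∑[ i < k ] (I ℓ (cls i) * 3)
        ≡⟨ *-distribʳ-sum 3 (λ i → I ℓ (cls i)) ⟨
      ∑[ i < k ] I ℓ (cls i) * 3
        ≡⟨ cong (_* 3) (sym (∑-classes (I ℓ))) ⟩
      S ℓ * 3
        ≡⟨ ℕ.*-comm (S ℓ) 3 ⟩
      3 * S ℓ ∎
      where open ≡-Reasoning

    -- Nine lines with at most seven points each give `3 * S ℓ ≤ 63`.
    line-class-bound : ∀ ℓ → S ℓ ≤ 21
    line-class-bound ℓ = ℕ.*-cancelˡ-≤ 3
      (subst (_≤ 63) (∑-line-class ℓ) (∑-mono-≤ {f = K ℓ} {g = λ _ → 7} (meets ℓ)))

    row-bound : ∀ ℓ x → I ℓ x ≡ 1 → ∀ j → 3 * f ℓ x j + S ℓ ≤ u x + 21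
    row-bound ℓ x x∈ℓ j = begin
      3 * f ℓ x j + S ℓ                            ≡⟨ ∑-slot ℓ x x∈ℓ j ⟨
      ∑[ s < 9 ] (δ (slot ℓ x s) j * K ℓ s) + u x
        ≤⟨ ℕ.+-monoˡ-≤ (u x) (∑-mono-≤ λ s → ℕ.*-monoʳ-≤ (δ (slot ℓ x s) j) (meets ℓ s)) ⟩
      ∑[ s < 9 ] (δ (slot ℓ x s) j * 7) + u x      ≡⟨ cong (_+ u x) (sym (*-distribʳ-sum 7 (λ s → δ (slot ℓ x s) j))) ⟩
      ∑[ s < 9 ] δ (slot ℓ x s) j * 7 + u x        ≡⟨ cong (λ c → c * 7 + u x) (slot-size ℓ x x∈ℓ j) ⟩
      21 + u x                                     ≡⟨ ℕ.+-comm 21 (u x) ⟩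
      u x + 21                                     ∎
      where open ℕ.≤-Reasoning

    -- The four rows through an arc point contain every other arc point of its class once and the
    -- point itself four times.
    ∑-rows-through : ∀ i₀ → ∑[ ℓ < v ] (I ℓ (cls i₀) * f ℓ (cls i₀) (row ℓ (cls i₀) (pos i₀))) ≡ u (cls i₀) + 3
    ∑-rows-through i₀ = begin
      ∑[ ℓ < v ] (I ℓ x * f ℓ x (row ℓ x (pos i₀)))
        ≡⟨ ∑-swap (λ ℓ → I ℓ x) (λ ℓ → inRow ℓ x (row ℓ x (pos i₀))) ⟩
      ∑[ i < k ] ∑[ ℓ < v ] (I ℓ x * inRow ℓ x (row ℓ x (pos i₀)) i)
        ≡⟨ sum-cong-≗ (λ i → pointwise i (cls i ≟ x)) ⟩
      ∑[ i < k ] (1 * δ (cls i) x + 3 * (1 * δ i₀ i))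
        ≡⟨ ∑-linear 1 3 (λ i → δ (cls i) x) (λ i → 1 * δ i₀ i) ⟩
      1 * u x + 3 * ∑[ i < k ] (1 * δ i₀ i)
        ≡⟨ cong₂ (λ a b → a + 3 * b) (ℕ.*-identityˡ (u x)) (∑-select (λ _ → 1) i₀) ⟩
      u x + 3 ∎
      where
      open ≡-Reasoning
      x = cls i₀
      -- Within one class, `injective` lets positions stand for indices of arc points.
      δ-pos : ∀ i → cls i ≡ x → δ (pos i) (pos i₀) ≡ δ i₀ i
      δ-pos i same with i₀ ≟ i
      ... | yes refl = δ-refl (pos i₀)
      ... | no i₀≢i = 𝟙-false (pos i ≟ pos i₀) λ eq → i₀≢i (injective (sym same) (sym eq))
      vanish : ∀ c d → c * (0 * d) ≡ 0
      vanish = solve-∀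
      pointwise : ∀ i → Dec (cls i ≡ x) →
        ∑[ ℓ < v ] (I ℓ x * inRow ℓ x (row ℓ x (pos i₀)) i) ≡ 1 * δ (cls i) x + 3 * (1 * δ i₀ i)
      pointwise i (no other) = begin
        ∑[ ℓ < v ] (I ℓ x * inRow ℓ x (row ℓ x (pos i₀)) i)
          ≡⟨ ∑-const-0 (λ ℓ → trans
               (cong (λ d → I ℓ x * (d * δ (row ℓ (cls i) (pos i)) (row ℓ x (pos i₀)))) (𝟙-false (cls i ≟ x) other))
               (vanish (I ℓ x) (δ (row ℓ (cls i) (pos i)) (row ℓ x (pos i₀))))) ⟩
        0
          ≡⟨ cong₂ (λ a b → 1 * a + 3 * (1 * b)) (𝟙-false (cls i ≟ x) other)
               (𝟙-false (i₀ ≟ i) λ eq → other (cong cls (sym eq))) ⟨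
        1 * δ (cls i) x + 3 * (1 * δ i₀ i) ∎
      pointwise i (yes same) = begin
        ∑[ ℓ < v ] (I ℓ x * inRow ℓ x (row ℓ x (pos i₀)) i)
          ≡⟨ sum-cong-≗ (λ ℓ → cong (I ℓ x *_) (trans
               (cong₂ (λ d y → d * δ (row ℓ y (pos i)) (row ℓ x (pos i₀))) (𝟙-true (cls i ≟ x) same) same)
               (ℕ.*-identityˡ _))) ⟩
        ∑[ ℓ < v ] (I ℓ x * δ (row ℓ x (pos i)) (row ℓ x (pos i₀)))
          ≡⟨ joining-rows x (pos i) (pos i₀) ⟩
        1 + 3 * δ (pos i) (pos i₀)
          ≡⟨ cong₂ (λ a b → 1 * a + 3 * b) (sym (𝟙-true (cls i ≟ x) same))
               (trans (δ-pos i same) (sym (ℕ.*-identityˡ _))) ⟩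
        1 * δ (cls i) x + 3 * (1 * δ i₀ i) ∎

    class-member : ∀ x → 0 < u x → ∃ λ i → cls i ≡ x
    class-member x 0<u = let i , 0<δ = ∑-positive (λ i → δ (cls i) x) 0<u in i , 𝟙-positive (cls i ≟ x) 0<δ

    row-member : ∀ ℓ x j → 0 < f ℓ x j → ∃ λ i → cls i ≡ x × row ℓ x (pos i) ≡ j
    row-member ℓ x j 0<f with ∑-positive (inRow ℓ x j) 0<f
    ... | i , 0<δδ with cls i ≟ x | row ℓ (cls i) (pos i) ≟ j
    ... | yes refl | yes on = i , refl , on

    -- Arcs of exactly 63 points

    module _ (size : k ≡ 63) where

      ∑-u : sum u ≡ 63
      ∑-u = begin
        sum u                   ≡⟨ sum-cong-≗ (λ x → sym (ℕ.*-identityˡ (u x))) ⟩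
        ∑[ x < v ] (1 * u x)   ≡⟨ ∑-classes (λ _ → 1) ⟩
        ∑[ _ < k ] 1            ≡⟨ ∑-const k 1 ⟩
        k * 1                   ≡⟨ ℕ.*-identityʳ k ⟩
        k                       ≡⟨ size ⟩
        63                      ∎
        where open ≡-Reasoning

      ∑-pencil-S : ∀ x → ∑[ ℓ < v ] (I ℓ x * S ℓ) ≡ 3 * u x + 63
      ∑-pencil-S x = trans (∑-pencil u x) (trans (ℕ.+-comm (sum u) (3 * u x)) (cong (3 * u x +_) ∑-u))

      ∑-through : ∀ i₀ → let x = cls i₀ in
        ∑[ ℓ < v ] (I ℓ x * (3 * f ℓ x (row ℓ x (pos i₀)) + S ℓ)) ≡ 6 * u x + 72
      ∑-through i₀ = begin
        ∑[ ℓ < v ] (I ℓ x * (3 * g ℓ + S ℓ))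
          ≡⟨ sum-cong-≗ (λ ℓ → regroup (I ℓ x) (g ℓ) (S ℓ)) ⟩
        ∑[ ℓ < v ] (3 * (I ℓ x * g ℓ) + 1 * (I ℓ x * S ℓ))
          ≡⟨ ∑-linear 3 1 (λ ℓ → I ℓ x * g ℓ) (λ ℓ → I ℓ x * S ℓ) ⟩
        3 * ∑[ ℓ < v ] (I ℓ x * g ℓ) + 1 * ∑[ ℓ < v ] (I ℓ x * S ℓ)
          ≡⟨ cong₂ (λ a b → 3 * a + 1 * b) (∑-rows-through i₀) (∑-pencil-S x) ⟩
        3 * (u x + 3) + 1 * (3 * u x + 63)
          ≡⟨ collect (u x) ⟩
        6 * u x + 72 ∎
        where
        open ≡-Reasoning
        x = cls i₀
        g : Fin v → ℕ
        g ℓ = f ℓ x (row ℓ x (pos i₀))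
        regroup : ∀ c a b → c * (3 * a + b) ≡ 3 * (c * a) + 1 * (c * b)
        regroup = solve-∀
        collect : ∀ v → 3 * (v + 3) + 1 * (3 * v + 63) ≡ 6 * v + 72
        collect = solve-∀

      -- For the rows through an arc point of `x`, the left sides of `row-bound` add up to
      -- `6 * u x + 72` and the right sides to `4 * u x + 84`.
      class-bound : ∀ x → u x ≤ 6
      class-bound x with u x in eq
      ... | zero  = z≤n
      ... | suc _ with class-member x (subst (0 <_) (sym eq) (s≤s z≤n))
      ... | i₀ , refl = subst (_≤ 6) eq (ℕ.*-cancelˡ-≤ 2 (ℕ.+-cancelˡ-≤ (4 * u x + 72) (2 * u x) 12 (begin
        4 * u x + 72 + 2 * u x         ≡⟨ left (u x) ⟩
        6 * u x + 72                   ≡⟨ ∑-through i₀ ⟨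
        ∑[ ℓ < v ] (I ℓ x * (3 * f ℓ x (row ℓ x (pos i₀)) + S ℓ))
                                       ≤⟨ ∑-mono-≤ (λ ℓ → binary-mono (I-binary ℓ x) λ x∈ℓ → row-bound ℓ x x∈ℓ _) ⟩
        ∑[ ℓ < v ] (I ℓ x * (u x + 21)) ≡⟨ ∑-pencil-const (u x + 21) x ⟩
        4 * (u x + 21)                 ≡⟨ right (u x) ⟩
        4 * u x + 72 + 12              ∎)))
        where
        open ℕ.≤-Reasoning
        left : ∀ v → 4 * v + 72 + 2 * v ≡ 6 * v + 72
        left = solve-∀
        right : ∀ v → 4 * (v + 21) ≡ 4 * v + 72 + 12
        right = solve-∀

      -- The total slack of `row-bound` over the four rows through an arc point is 12 − 2 u x.
      six-row : ∀ {x} → u x ≡ 6 → ∀ ℓ → I ℓ x ≡ 1 → ∀ j → f ℓ x j ≡ 0 ⊎ 3 * f ℓ x j + S ℓ ≡ 27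
      six-row {x} u≡6 ℓ x∈ℓ j with f ℓ x j in eq
      ... | zero  = inj₁ refl
      ... | suc _ with row-member ℓ x j (subst (0 <_) (sym eq) (s≤s z≤n))
      ... | i₀ , refl , refl = inj₂ (subst (λ w → 3 * w + S ℓ ≡ 27) eq (ℕ.≤-antisym
        (subst (λ v → 3 * f ℓ x j + S ℓ ≤ v + 21) u≡6 (row-bound ℓ x x∈ℓ j))
        (ℕ.+-cancelʳ-≤ 108 27 (3 * f ℓ x j + S ℓ) (begin
          27 + 108
            ≡⟨ cong₂ _+_ (cong (_+ 21) u≡6) (trans (∑-through i₀) (cong (λ v → 6 * v + 72) u≡6)) ⟨
          u x + 21 + ∑[ m < v ] (I m x * a m)
            ≤⟨ pencil-slack x a (λ _ → u x + 21) (λ m x∈m → row-bound m x x∈m _) ℓ x∈ℓ ⟩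
          a ℓ + ∑[ m < v ] (I m x * (u x + 21))
            ≡⟨ cong (a ℓ +_) (trans (∑-pencil-const (u x + 21) x) (cong (λ v → 4 * (v + 21)) u≡6)) ⟩
          3 * f ℓ x j + S ℓ + 108 ∎))))
        where
        open ℕ.≤-Reasoning
        a : Fin v → ℕ
        a m = 3 * f m x (row m x (pos i₀)) + S m

      -- Over the pencil of `x` the values of `S` add up to 81, only 3 less than four times 21.
      six-S≥18 : ∀ {x} → u x ≡ 6 → ∀ ℓ → I ℓ x ≡ 1 → 18 ≤ S ℓ
      six-S≥18 {x} u≡6 ℓ x∈ℓ = ℕ.+-cancelʳ-≤ 84 18 (S ℓ) (begin
        18 + 84                               ≡⟨ cong (21 +_) (trans (∑-pencil-S x) (cong (λ v → 3 * v + 63) u≡6)) ⟨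
        21 + ∑[ m < v ] (I m x * S m)        ≤⟨ pencil-slack x S (λ _ → 21) (λ m _ → line-class-bound m) ℓ x∈ℓ ⟩
        S ℓ + ∑[ m < v ] (I m x * 21)        ≡⟨ cong (S ℓ +_) (∑-pencil-const 21 x) ⟩
        S ℓ + 84                              ∎)
        where open ℕ.≤-Reasoning

      six-line : ∀ {x} → u x ≡ 6 → ∀ ℓ → I ℓ x ≡ 1 → S ℓ ≡ 21 ⊎ (S ℓ ≡ 18 × ∃ λ j → f ℓ x j ≡ 0)
      six-line {x} u≡6 ℓ x∈ℓ = six-rows (f ℓ x) (six-S≥18 u≡6 ℓ x∈ℓ) (line-class-bound ℓ)
        (six-row u≡6 ℓ x∈ℓ) (trans (∑-rows ℓ x) u≡6)

      -- The four lines of ℓ avoiding both empty rows carry at most 28 points, and the lines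
      -- through either empty row carry 12, but the nine lines together carry 3 S ℓ = 54.
      two-sixes : ∀ {x y} → u x ≡ 6 → u y ≡ 6 → y ≢ x → ∀ ℓ → I ℓ x ≡ 1 → I ℓ y ≡ 1 → S ℓ ≡ 18 →
        ∀ j k → f ℓ x j ≡ 0 → f ℓ y k ≡ 0 → ⊥
      two-sixes {x} {y} ux≡6 uy≡6 y≢x ℓ x∈ℓ y∈ℓ S≡18 j k fx≡0 fy≡0 = ℕ.<⇒≱ (ℕ.m≤m+n 53 1) (begin
        54                                          ≡⟨ trans (∑-line-class ℓ) (cong (3 *_) S≡18) ⟨
        ∑[ s < 9 ] K ℓ s                            ≤⟨ ∑-mono-≤ {f = K ℓ} pointwise ⟩
        ∑[ s < 9 ] (7 * ω s + (α s * K ℓ s + β s * K ℓ s))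
          ≡⟨ trans (∑-distrib-+ (λ s → 7 * ω s) (λ s → α s * K ℓ s + β s * K ℓ s))
               (cong₂ _+_ (∑-scale 7 ω) (∑-distrib-+ (λ s → α s * K ℓ s) (λ s → β s * K ℓ s))) ⟩
        7 * ∑[ s < 9 ] ω s + (∑[ s < 9 ] (α s * K ℓ s) + ∑[ s < 9 ] (β s * K ℓ s))
          ≤⟨ ℕ.+-mono-≤ (ℕ.*-monoʳ-≤ 7 (slots-avoid ℓ x x∈ℓ y y∈ℓ (𝟙-false (y ≟ x) y≢x) j k))
               (ℕ.≤-reflexive (cong₂ _+_ (empty-row x x∈ℓ ux≡6 j fx≡0) (empty-row y y∈ℓ uy≡6 k fy≡0))) ⟩
        52                                          ∎)
        where
        open ℕ.≤-Reasoning
        α β ω : Fin 9 → ℕ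
        α s = δ (slot ℓ x s) j
        β s = δ (slot ℓ y s) k
        ω s = (1 ∸ α s) * (1 ∸ β s)
        empty-row : ∀ z → I ℓ z ≡ 1 → u z ≡ 6 → ∀ i → f ℓ z i ≡ 0 → ∑[ s < 9 ] (δ (slot ℓ z s) i * K ℓ s) ≡ 12
        empty-row z z∈ℓ uz≡6 i fz≡0 = ℕ.+-cancelʳ-≡ 6 (∑[ s < 9 ] (δ (slot ℓ z s) i * K ℓ s)) 12
          (trans (cong (∑[ s < 9 ] (δ (slot ℓ z s) i * K ℓ s) +_) (sym uz≡6))
            (trans (∑-slot ℓ z z∈ℓ i) (cong₂ (λ a b → 3 * a + b) fz≡0 S≡18)))
        bound : ∀ {a b c} → a ≡ 0 ⊎ a ≡ 1 → b ≡ 0 ⊎ b ≡ 1 → c ≤ 7 → c ≤ 7 * ((1 ∸ a) * (1 ∸ b)) + (a * c + b * c)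
        bound (inj₁ refl) (inj₁ refl) c≤7 = c≤7
        bound {c = c} (inj₁ refl) (inj₂ refl) _ = ℕ.≤-reflexive (sym (ℕ.+-identityʳ c))
        bound {b = b} {c} (inj₂ refl) _ _ =
          ℕ.≤-trans (ℕ.≤-reflexive (sym (ℕ.+-identityʳ c))) (ℕ.m≤m+n (c + 0) (b * c))
        pointwise : ∀ s → K ℓ s ≤ 7 * ω s + (α s * K ℓ s + β s * K ℓ s)
        pointwise s = bound (𝟙-binary (slot ℓ x s ≟ j)) (𝟙-binary (slot ℓ y s ≟ k)) (meets ℓ s)

      -- Excluding classes with six points

      χ : Fin v → ℕ
      χ x = 𝟙 (u x ℕ.≟ 6)

      e : Fin v → ℕ
      e ℓ = 𝟙 (S ℓ ℕ.≟ 18)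

      w : Fin v → ℕ
      w = weight χ

      -- With `S ℓ ≡ 21`, `row-bound` becomes `3 * f ℓ x j ≤ u x`, so each `u x` on `ℓ` is 0, 3 or 6
      -- by `thirds`. Four such numbers with sum 21 must be 6, 6, 6, 3.
      full-line : ∀ ℓ → S ℓ ≡ 21 → w ℓ ≡ 3
      full-line ℓ S≡21 = ℕ.≤-antisym w≤3 w≥3
        where
        open ℕ.≤-Reasoning
        -- Linear bounds in the indicator that hold for 0, 3 and 6; summed over `ℓ` they give
        -- `6 * w ℓ ≤ 21` and `21 ≤ 12 + 3 * w ℓ`.
        thirds-χ : ∀ {t} g → t ≡ 3 * g → t ≤ 6 → 6 * 𝟙 (t ℕ.≟ 6) ≤ t × t ≤ 3 + 3 * 𝟙 (t ℕ.≟ 6)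
        thirds-χ 0 refl _ = z≤n , z≤n
        thirds-χ 1 refl _ = z≤n , ℕ.≤-refl
        thirds-χ 2 refl _ = ℕ.≤-refl , ℕ.≤-refl
        thirds-χ (suc (suc (suc g))) refl t≤6 = contradiction (ℕ.*-cancelˡ-≤ {3 + g} {2} 3 t≤6) λ { (s≤s (s≤s ())) }
        local : ∀ x → I ℓ x ≡ 1 → 6 * χ x ≤ u x × u x ≤ 3 + 3 * χ x
        local x x∈ℓ = thirds-χ (f ℓ x 0F)
          (thirds (f ℓ x)
            (λ j → ℕ.+-cancelʳ-≤ 21 (3 * f ℓ x j) (u x)
              (subst (λ t → 3 * f ℓ x j + t ≤ u x + 21) S≡21 (row-bound ℓ x x∈ℓ j)))
            (∑-rows ℓ x))
          (class-bound x)
        exchange : ∀ a b c → a * (b * c) ≡ b * (a * c)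
        exchange = solve-∀
        regroup : ∀ a b → a * (3 + 3 * b) ≡ 3 * a + 3 * (a * b)
        regroup = solve-∀
        w≤3 : w ℓ ≤ 3
        w≤3 = ℕ.≤-pred (ℕ.*-cancelˡ-< 6 (w ℓ) 4 (begin-strict
          6 * w ℓ                           ≡⟨ ∑-scale 6 (λ x → I ℓ x * χ x) ⟨
          ∑[ x < v ] (6 * (I ℓ x * χ x))    ≡⟨ sum-cong-≗ (λ x → exchange 6 (I ℓ x) (χ x)) ⟩
          ∑[ x < v ] (I ℓ x * (6 * χ x))    ≤⟨ ∑-mono-≤ (λ x → binary-mono (I-binary ℓ x) λ x∈ℓ → proj₁ (local x x∈ℓ)) ⟩
          S ℓ                               ≡⟨ S≡21 ⟩
          21                                <⟨ ℕ.m≤m+n 22 2 ⟩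
          24                                ∎))
        w≥3 : 3 ≤ w ℓ
        w≥3 = ℕ.*-cancelˡ-≤ 3 (ℕ.+-cancelˡ-≤ 12 9 (3 * w ℓ) (begin
          21                                ≡⟨ S≡21 ⟨
          S ℓ                               ≤⟨ ∑-mono-≤ (λ x → binary-mono (I-binary ℓ x) λ x∈ℓ → proj₂ (local x x∈ℓ)) ⟩
          ∑[ x < v ] (I ℓ x * (3 + 3 * χ x))  ≡⟨ sum-cong-≗ (λ x → regroup (I ℓ x) (χ x)) ⟩
          ∑[ x < v ] (3 * I ℓ x + 3 * (I ℓ x * χ x))  ≡⟨ ∑-linear 3 3 (I ℓ) (λ x → I ℓ x * χ x) ⟩
          3 * ∑[ x < v ] I ℓ x + 3 * w ℓ    ≡⟨ cong (λ c → 3 * c + 3 * w ℓ) (line-size ℓ) ⟩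
          12 + 3 * w ℓ                      ∎))

      -- A second six on `ℓ` would have an empty row just as `x` does, against `two-sixes`; so `x`
      -- is the only one.
      short-line : ∀ {x} → u x ≡ 6 → ∀ ℓ → I ℓ x ≡ 1 → S ℓ ≡ 18 → w ℓ ≡ 1
      short-line {x} u≡6 ℓ x∈ℓ S≡18 = trans (sum-cong-≗ pointwise) (∑-select (λ _ → 1) x)
        where
        zero-row : ∀ {y} → u y ≡ 6 → I ℓ y ≡ 1 → ∃ λ j → f ℓ y j ≡ 0
        zero-row uy≡6 y∈ℓ with six-line uy≡6 ℓ y∈ℓ
        ... | inj₁ S≡21 = contradiction (trans (sym S≡18) S≡21) λ ()
        ... | inj₂ (_ , row) = row
        pointwise : ∀ y → I ℓ y * χ y ≡ 1 * δ x y
        pointwise y = by-cases (x ≟ y) (I-binary ℓ y) (u y ℕ.≟ 6)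
          where
          by-cases : Dec (x ≡ y) → I ℓ y ≡ 0 ⊎ I ℓ y ≡ 1 → Dec (u y ≡ 6) → I ℓ y * χ y ≡ 1 * δ x y
          by-cases (yes refl) _ _ = trans (cong₂ _*_ x∈ℓ (𝟙-true (u x ℕ.≟ 6) u≡6)) (cong (1 *_) (sym (δ-refl x)))
          by-cases (no x≢y) (inj₁ y∉ℓ) _ = trans (cong (_* χ y) y∉ℓ) (cong (1 *_) (sym (𝟙-false (x ≟ y) x≢y)))
          by-cases (no x≢y) (inj₂ _) (no uy≢6) = trans
            (trans (cong (I ℓ y *_) (𝟙-false (u y ℕ.≟ 6) uy≢6)) (ℕ.*-zeroʳ (I ℓ y)))
            (cong (1 *_) (sym (𝟙-false (x ≟ y) x≢y)))
          by-cases (no x≢y) (inj₂ y∈ℓ) (yes uy≡6) =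
            let j , fx≡0 = zero-row u≡6 x∈ℓ ; k , fy≡0 = zero-row uy≡6 y∈ℓ
            in ⊥-elim (two-sixes u≡6 uy≡6 (x≢y ∘ sym) ℓ x∈ℓ y∈ℓ S≡18 j k fx≡0 fy≡0)

      six-line-type : ∀ {x} → u x ≡ 6 → ∀ ℓ → I ℓ x ≡ 1 →
        (S ℓ ≡ 21 × w ℓ ≡ 3 × e ℓ ≡ 0) ⊎ (S ℓ ≡ 18 × w ℓ ≡ 1 × e ℓ ≡ 1)
      six-line-type u≡6 ℓ x∈ℓ with six-line u≡6 ℓ x∈ℓ
      ... | inj₁ S≡21 = inj₁ (S≡21 , full-line ℓ S≡21 ,
        𝟙-false (S ℓ ℕ.≟ 18) λ S≡18 → contradiction (trans (sym S≡18) S≡21) λ ())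
      ... | inj₂ (S≡18 , _) = inj₂ (S≡18 , short-line u≡6 ℓ x∈ℓ S≡18 , 𝟙-true (S ℓ ℕ.≟ 18) S≡18)

      -- Each line class through `x` satisfies `3 * e ℓ + S ℓ ≡ 21`, and the values of `S` add up to
      -- 81 instead of 84, so exactly one of them is 18.
      ∑-pencil-e : ∀ {x} → u x ≡ 6 → ∑[ ℓ < v ] (I ℓ x * e ℓ) ≡ 1
      ∑-pencil-e {x} u≡6 = ℕ.*-cancelˡ-≡ E 1 3 (ℕ.+-cancelʳ-≡ 81 (3 * E) 3 (begin
        3 * E + 81                                    ≡⟨ cong (3 * E +_) (trans (∑-pencil-S x) (cong (λ t → 3 * t + 63) u≡6)) ⟨
        3 * E + ∑[ ℓ < v ] (I ℓ x * S ℓ)              ≡⟨ cong (3 * E +_) (ℕ.*-identityˡ (∑[ ℓ < v ] (I ℓ x * S ℓ))) ⟨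
        3 * E + 1 * ∑[ ℓ < v ] (I ℓ x * S ℓ)          ≡⟨ ∑-linear 3 1 (λ ℓ → I ℓ x * e ℓ) (λ ℓ → I ℓ x * S ℓ) ⟨
        ∑[ ℓ < v ] (3 * (I ℓ x * e ℓ) + 1 * (I ℓ x * S ℓ))
          ≡⟨ sum-cong-≗ (λ ℓ → trans (regroup (I ℓ x) (e ℓ) (S ℓ)) (binary-cong (I-binary ℓ x) (local ℓ))) ⟩
        ∑[ ℓ < v ] (I ℓ x * 21)                       ≡⟨ ∑-pencil-const 21 x ⟩
        84                                            ∎))
        where
        open ≡-Reasoning
        E = ∑[ ℓ < v ] (I ℓ x * e ℓ)
        regroup : ∀ a b c → 3 * (a * b) + 1 * (a * c) ≡ a * (3 * b + c)
        regroup = solve-∀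
        local : ∀ ℓ → I ℓ x ≡ 1 → 3 * e ℓ + S ℓ ≡ 21
        local ℓ x∈ℓ with six-line-type u≡6 ℓ x∈ℓ
        ... | inj₁ (S≡ , _ , e≡) = cong₂ (λ a b → 3 * a + b) e≡ S≡
        ... | inj₂ (S≡ , _ , e≡) = cong₂ (λ a b → 3 * a + b) e≡ S≡

      -- The pencil of `x` has three line classes with three sixes and one with a single six. In
      -- these 10 incidences `x` occurs four times and every other six once.
      six-count : ∀ {x} → u x ≡ 6 → sum χ ≡ 7
      six-count {x} u≡6 = ℕ.+-cancelʳ-≡ 5 (sum χ) 7 (begin
        sum χ + 5
          ≡⟨ cong₂ (λ a b → sum χ + (3 * a + 2 * b)) (𝟙-true (u x ℕ.≟ 6) u≡6) (∑-pencil-e u≡6) ⟨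
        sum χ + (3 * χ x + 2 * E)                     ≡⟨ ℕ.+-assoc (sum χ) (3 * χ x) (2 * E) ⟨
        sum χ + 3 * χ x + 2 * E                       ≡⟨ cong (_+ 2 * E) (∑-pencil χ x) ⟨
        ∑[ ℓ < v ] (I ℓ x * w ℓ) + 2 * E              ≡⟨ cong (_+ 2 * E) (ℕ.*-identityˡ (∑[ ℓ < v ] (I ℓ x * w ℓ))) ⟨
        1 * ∑[ ℓ < v ] (I ℓ x * w ℓ) + 2 * E          ≡⟨ ∑-linear 1 2 (λ ℓ → I ℓ x * w ℓ) (λ ℓ → I ℓ x * e ℓ) ⟨
        ∑[ ℓ < v ] (1 * (I ℓ x * w ℓ) + 2 * (I ℓ x * e ℓ))
          ≡⟨ sum-cong-≗ (λ ℓ → trans (regroup (I ℓ x) (w ℓ) (e ℓ)) (binary-cong (I-binary ℓ x) (local ℓ))) ⟩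
        ∑[ ℓ < v ] (I ℓ x * 3)                        ≡⟨ ∑-pencil-const 3 x ⟩
        12                                            ∎)
        where
        open ≡-Reasoning
        E = ∑[ ℓ < v ] (I ℓ x * e ℓ)
        regroup : ∀ a b c → 1 * (a * b) + 2 * (a * c) ≡ a * (b + 2 * c)
        regroup = solve-∀
        local : ∀ ℓ → I ℓ x ≡ 1 → w ℓ + 2 * e ℓ ≡ 3
        local ℓ x∈ℓ with six-line-type u≡6 ℓ x∈ℓ
        ... | inj₁ (_ , w≡ , e≡) = cong₂ (λ a b → a + 2 * b) w≡ e≡
        ... | inj₂ (_ , w≡ , e≡) = cong₂ (λ a b → a + 2 * b) w≡ e≡

      -- Incidences between sixes and line classes are counted twice with weight `ν`, which is 3 on
      -- a short line to make up for its single six. The seven sixes give 42, but the 13 line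
      -- classes at most 39.
      no-six : ∀ {x} → u x ≢ 6
      no-six u≡6 = ℕ.<⇒≱ (ℕ.m≤m+n 40 2) (begin
        42                                            ≡⟨ cong (_* 6) (six-count u≡6) ⟨
        sum χ * 6                                     ≡⟨ *-distribʳ-sum 6 χ ⟩
        ∑[ x < v ] (χ x * 6)                          ≡⟨ sum-cong-≗ (λ x → binary-cong (𝟙-binary (u x ℕ.≟ 6)) (pencil-ν x)) ⟨
        ∑[ x < v ] (χ x * ∑[ ℓ < v ] (I ℓ x * ν ℓ))   ≡⟨ ∑-swap χ (λ x ℓ → I ℓ x * ν ℓ) ⟩
        ∑[ ℓ < v ] ∑[ x < v ] (χ x * (I ℓ x * ν ℓ))
          ≡⟨ sum-cong-≗ (λ ℓ → trans (sum-cong-≗ λ x → regroup (χ x) (I ℓ x) (ν ℓ))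
               (sym (*-distribʳ-sum (ν ℓ) (λ x → I ℓ x * χ x)))) ⟩
        ∑[ ℓ < v ] (w ℓ * ν ℓ)                        ≤⟨ ∑-mono-≤ line-ν ⟩
        ∑[ ℓ < v ] 3                                  ≡⟨ ∑-classes-const 3 ⟩
        39                                            ∎)
        where
        open ℕ.≤-Reasoning
        -- The lines through a six weigh 6, while w ℓ * ν ℓ ≤ 3 on each of the 13 lines.
        ν : Fin v → ℕ
        ν ℓ = 1 + 2 * e ℓ
        regroup : ∀ a b c → a * (b * c) ≡ b * a * c
        regroup = solve-∀
        distribute : ∀ a b → a * (1 + 2 * b) ≡ 1 * a + 2 * (a * b)
        distribute = solve-∀
        pencil-ν : ∀ x → χ x ≡ 1 → ∑[ ℓ < v ] (I ℓ x * ν ℓ) ≡ 6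
        pencil-ν x χ≡1 = trans (sum-cong-≗ λ ℓ → distribute (I ℓ x) (e ℓ))
          (trans (∑-linear 1 2 (λ ℓ → I ℓ x) (λ ℓ → I ℓ x * e ℓ))
            (cong₂ (λ a b → 1 * a + 2 * b) (pencil-size x)
              (∑-pencil-e (𝟙-positive (u x ℕ.≟ 6) (subst (0 <_) (sym χ≡1) (s≤s z≤n))))))
        line-ν : ∀ ℓ → w ℓ * ν ℓ ≤ 3
        line-ν ℓ with w ℓ in eq
        ... | zero = z≤n
        ... | suc _ with ∑-positive (λ x → I ℓ x * χ x) (subst (0 <_) (sym eq) (s≤s z≤n))
        ... | x , 0<Iχ with I-binary ℓ x
        ... | inj₁ x∉ℓ = contradiction (subst (λ c → 0 < c * χ x) x∉ℓ 0<Iχ) λ ()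
        ... | inj₂ x∈ℓ
          with six-line-type (𝟙-positive (u x ℕ.≟ 6)
            (subst (0 <_) (trans (cong (_* χ x) x∈ℓ) (ℕ.*-identityˡ (χ x))) 0<Iχ)) ℓ x∈ℓ
        ... | inj₁ (_ , w≡3 , e≡0) = ℕ.≤-reflexive (cong₂ (λ a b → a * (1 + 2 * b)) (trans (sym eq) w≡3) e≡0)
        ... | inj₂ (_ , w≡1 , e≡1) = ℕ.≤-reflexive (cong₂ (λ a b → a * (1 + 2 * b)) (trans (sym eq) w≡1) e≡1)

      -- Excluding classes with five points

      class-bound-5 : ∀ x → u x ≤ 5
      class-bound-5 x = ℕ.≤-pred (ℕ.≤∧≢⇒< (class-bound x) no-six)

      -- The nine classes off `ℓ` hold at most 45 of the 63 points.
      line-class-large : ∀ ℓ → 18 ≤ S ℓ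
      line-class-large ℓ = ℕ.+-cancelʳ-≤ 65 18 (S ℓ) (begin
        83                                          ≡⟨ cong₂ (λ a b → 1 * a + 5 * b) ∑-u (line-size ℓ) ⟨
        1 * sum u + 5 * ∑[ x < v ] I ℓ x            ≡⟨ ∑-linear 1 5 u (I ℓ) ⟨
        ∑[ x < v ] (1 * u x + 5 * I ℓ x)            ≤⟨ ∑-mono-≤ (λ x → local (I-binary ℓ x) (class-bound-5 x)) ⟩
        ∑[ x < v ] (I ℓ x * u x + 5)                ≡⟨ ∑-distrib-+ (λ x → I ℓ x * u x) (λ _ → 5) ⟩
        S ℓ + ∑[ x < v ] 5                          ≡⟨ cong (S ℓ +_) (∑-classes-const 5) ⟩
        S ℓ + 65                                    ∎)
        where
        open ℕ.≤-Reasoning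
        local : ∀ {c t} → c ≡ 0 ⊎ c ≡ 1 → t ≤ 5 → 1 * t + 5 * c ≤ c * t + 5
        local {t = t} (inj₁ refl) t≤5 = ℕ.≤-trans (ℕ.≤-reflexive (trans (ℕ.+-identityʳ (1 * t)) (ℕ.*-identityˡ t))) t≤5
        local (inj₂ refl) _ = ℕ.≤-refl

      five-row : ∀ {x} → u x ≡ 5 → ∀ ℓ → I ℓ x ≡ 1 → ∀ j → f ℓ x j ≤ 2
      five-row {x} u≡5 ℓ x∈ℓ j = ℕ.≤-pred (ℕ.*-cancelˡ-< 3 (f ℓ x j) 3 (s≤s (ℕ.+-cancelʳ-≤ 18 (3 * f ℓ x j) 8 (begin
        3 * f ℓ x j + 18   ≤⟨ ℕ.+-monoʳ-≤ (3 * f ℓ x j) (line-class-large ℓ) ⟩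
        3 * f ℓ x j + S ℓ  ≤⟨ row-bound ℓ x x∈ℓ j ⟩
        u x + 21           ≡⟨ cong (_+ 21) u≡5 ⟩
        26                 ∎))))
        where open ℕ.≤-Reasoning

      -- The four rows through an arc point of `x` have total 5 + 3, and none exceeds 2, so each is
      -- exactly 2.
      five-row-even : ∀ {x} → u x ≡ 5 → ∀ ℓ → I ℓ x ≡ 1 → ∀ j → f ℓ x j ≡ 0 ⊎ f ℓ x j ≡ 2
      five-row-even {x} u≡5 ℓ x∈ℓ j with f ℓ x j in eq
      ... | zero = inj₁ refl
      ... | suc _ with row-member ℓ x j (subst (0 <_) (sym eq) (s≤s z≤n))
      ... | i₀ , refl , refl = inj₂ (trans (sym eq) (ℕ.≤-antisym (five-row u≡5 ℓ x∈ℓ j)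
        (ℕ.+-cancelʳ-≤ 8 2 (f ℓ x j) (begin
          2 + 8                              ≡⟨ cong (2 +_) (trans (∑-rows-through i₀) (cong (_+ 3) u≡5)) ⟨
          2 + ∑[ m < v ] (I m x * a m)       ≤⟨ pencil-slack x a (λ _ → 2) (λ m x∈m → five-row u≡5 m x∈m _) ℓ x∈ℓ ⟩
          a ℓ + ∑[ m < v ] (I m x * 2)       ≡⟨ cong (a ℓ +_) (∑-pencil-const 2 x) ⟩
          f ℓ x j + 8                        ∎))))
        where
        open ℕ.≤-Reasoning
        a : Fin v → ℕ
        a m = f m x (row m x (pos i₀))

      no-five : ∀ {x} → u x ≢ 5
      no-five {x} u≡5 with ∑-positive (λ ℓ → I ℓ x) (subst (0 <_) (sym (pencil-size x)) (s≤s z≤n))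
      ... | ℓ , 0<I with I-binary ℓ x
      ... | inj₁ x∉ℓ = contradiction (subst (0 <_) x∉ℓ 0<I) λ ()
      ... | inj₂ x∈ℓ = five-rows (f ℓ x) (five-row-even u≡5 ℓ x∈ℓ) (trans (∑-rows ℓ x) u≡5)

      no-arc : ⊥
      no-arc = ℕ.<⇒≱ (ℕ.m≤m+n 53 10) (begin
        63              ≡⟨ ∑-u ⟨
        sum u           ≤⟨ ∑-mono-≤ (λ x → ℕ.≤-pred (ℕ.≤∧≢⇒< (class-bound-5 x) no-five)) ⟩
        ∑[ _ < v ] 4    ≡⟨ ∑-classes-const 4 ⟩
        52              ∎)
        where open ℕ.≤-Reasoning

-- Dropping points never raises the count on a line; this cuts a larger arc down to 63 points.
restrict : ∀ {v} {plane : HjelmslevPlane v} k m {n} → Arc plane (k + m) n → Arc plane k n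
restrict k m arc = record
  { cls       = λ i → cls (i ↑ˡ m)
  ; pos       = λ i → pos (i ↑ˡ m)
  ; injective = λ same-cls same-pos → ↑ˡ-injective m _ _ (injective same-cls same-pos)
  ; meets     = λ ℓ s → ℕ.≤-trans (∑-↑ˡ k m _) (meets ℓ s)
  } where open Arc arc

-- Coordinates over Z₉ and S₃

-- The hidden argument is solved once `P?` evaluates to `yes`, so finite statements are proved by
-- exhaustive computation.
by-decision : {P : Set p} (P? : Dec P) {_ : True P?} → P
by-decision P? {holds} = toWitness holds

open Modular 3 using (_⊕_; _⊗_)

-- finite a b, infinite a and pole are the points (1 : a : b), (0 : 1 : a) and (0 : 0 : 1), and
-- as lines they are given by x₀ = a x₁ + b x₂, x₁ = a x₂ and x₂ = 0.
data PG : Set where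
  finite   : F₃ → F₃ → PG
  infinite : F₃ → PG
  pole     : PG

class : Fin 13 → PG
class x = [ (λ y → uncurry finite (remQuot 3 y))
          , (λ { 0F → infinite 0F ; 1F → infinite 1F ; 2F → infinite 2F ; 3F → pole })
          ]′ (splitAt 9 x)

index : PG → Fin 13
index (finite a b) = combine a b ↑ˡ 4
index (infinite a) = 9 ↑ʳ (a ↑ˡ 1)
index pole         = 9 ↑ʳ 3F

class-index : ∀ c → class (index c) ≡ c
class-index (finite 0F 0F) = refl
class-index (finite 0F 1F) = refl
class-index (finite 0F 2F) = refl
class-index (finite 1F 0F) = refl
class-index (finite 1F 1F) = refl
class-index (finite 1F 2F) = refl
class-index (finite 2F 0F) = refl
class-index (finite 2F 1F) = refl
class-index (finite 2F 2F) = refl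
class-index (infinite 0F)  = refl
class-index (infinite 1F)  = refl
class-index (infinite 2F)  = refl
class-index pole           = refl

-- A missing parameter is filled with 0: the coordinate there lies in the radical, with zero residue
-- and a free π-digit.
parameters : PG → F₃ × F₃
parameters (finite a b) = a , b
parameters (infinite a) = 0F , a
parameters pole         = 0F , 0F

module _ {A : Set p} where

  -- For a point, `place` moves the coordinate normalised to 1 from the front to its position. For a
  -- line, the inverse `arrange` brings the coordinate that its equation solves for to the front.
  place arrange : PG → A × A × A → A × A × A
  place (finite _ _) (a , b , c) = a , b , c
  place (infinite _) (a , b , c) = b , a , c
  place pole         (a , b , c) = b , c , a
  arrange (finite _ _) (a , b , c) = a , b , c
  arrange (infinite _) (a , b , c) = b , a , c
  arrange pole         (a , b , c) = c , a , b

residue : PG → F₃ × F₃ × F₃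
residue c = place c (1F , parameters c)

incident? : (ℓ x : Fin 13) → Dec _
incident? ℓ x =
  let a , b = parameters (class ℓ) ; z₀ , z₁ , z₂ = arrange (class ℓ) (residue (class x))
  in z₀ ≟ (a ⊗ z₁) ⊕ (b ⊗ z₂)

I : Fin 13 → Fin 13 → ℕ
I ℓ x = 𝟙 (incident? ℓ x)

-- The π-digit of `s₁ π z₁ + s₂ π z₂`. As π squares to 0, only the residues of `z₁` and `z₂` matter,
-- and the same formula serves both rings.
slot : Fin 13 → Fin 13 → Fin 9 → F₃
slot ℓ x s =
  let s₁ , s₂ = remQuot 3 s ; _ , z₁ , z₂ = arrange (class ℓ) (residue (class x))
  in (s₁ ⊗ z₁) ⊕ (s₂ ⊗ z₂)

-- This and the next four facts involve residues only and are checked once for both rings.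
line-size : ∀ ℓ → ∑[ x < 13 ] I ℓ x ≡ 4
line-size = by-decision (all? λ x → _ ℕ.≟ _)

joining-lines : ∀ x y → ∑[ ℓ < 13 ] (I ℓ x * I ℓ y) ≡ 1 + 3 * δ x y
joining-lines = by-decision (all? λ x → all? λ y → _ ℕ.≟ _)

slot-size : ∀ ℓ x → I ℓ x ≡ 1 → ∀ j → ∑[ s < 9 ] δ (slot ℓ x s) j ≡ 3
slot-size = by-decision (all? λ ℓ → all? λ x → (I ℓ x ℕ.≟ 1) →-dec all? λ j → _ ℕ.≟ _)

slots-meet : ∀ ℓ x → I ℓ x ≡ 1 → ∀ y → I ℓ y ≡ 1 → ∀ j k →
  ∑[ s < 9 ] (δ (slot ℓ x s) j * δ (slot ℓ y s) k) + δ y x ≡ 3 * (δ y x * δ k j) + 1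
slots-meet = by-decision (all? λ ℓ → all? λ x → (I ℓ x ℕ.≟ 1) →-dec all? λ y →
  (I ℓ y ℕ.≟ 1) →-dec all? λ j → all? λ k → _ ℕ.≟ _)

slots-avoid : ∀ ℓ x → I ℓ x ≡ 1 → ∀ y → I ℓ y ≡ 1 → δ y x ≡ 0 → ∀ j k →
  ∑[ s < 9 ] ((1 ∸ δ (slot ℓ x s) j) * (1 ∸ δ (slot ℓ y s) k)) ≤ 4
slots-avoid = by-decision (all? λ ℓ → all? λ x → (I ℓ x ℕ.≟ 1) →-dec all? λ y →
  (I ℓ y ℕ.≟ 1) →-dec ((δ y x ℕ.≟ 0) →-dec all? λ j → all? λ k → _ ℕ.≤? _))

-- ⟨ a , b ⟩ stands for a + b π, where π generates the radical of R.
module Coordinates (R : Ring 0ℓ 0ℓ) (⟨_,_⟩ : F₃ → F₃ → Ring.Carrier R) (digits : Ring.Carrier R → F₃ × F₃) where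

  open Ring R using (_≈_; 0#; 1#; _-_) renaming (_+_ to _+ʳ_; _*_ to _*ʳ_)
  open RightModule (PHG₂.R³ R) using (Carrierᴹ)

  vector : PG → F₃ → F₃ → Carrierᴹ
  vector c t₁ t₂ = let a , b = parameters c in place c (1# , ⟨ a , t₁ ⟩ , ⟨ b , t₂ ⟩)

  pointVector : Fin 13 → Fin 9 → Carrierᴹ
  pointVector x t = uncurry (vector (class x)) (remQuot 3 t)

  OnLine : PG → F₃ → F₃ → Carrierᴹ → Set
  OnLine c s₁ s₂ z =
    let a , b = parameters c ; z₀ , z₁ , z₂ = arrange c z
    in z₀ ≈ ⟨ a , s₁ ⟩ *ʳ z₁ +ʳ ⟨ b , s₂ ⟩ *ʳ z₂

  -- The π-digit of z₀ − (a z₁ + b z₂); replacing a, b by a + s₁ π, b + s₂ π lowers it by slot ℓ x s.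
  row : Fin 13 → Fin 13 → Fin 9 → F₃
  row ℓ x t =
    let a , b = parameters (class ℓ) ; z₀ , z₁ , z₂ = arrange (class ℓ) (pointVector x t)
    in proj₂ (digits (z₀ - (⟨ a , 0F ⟩ *ʳ z₁ +ʳ ⟨ b , 0F ⟩ *ʳ z₂)))

  -- The first five fields bring generators of points into normal form. The last two tie the model
  -- to the ring, `incidence` turning an equality of slot and row into the equation of a line.
  record IsCoordinatisation : Set where
    field
      digits-correct : ∀ r → r ≈ uncurry ⟨_,_⟩ (digits r)
      unit           : ∀ a b → a ≢ 0F → ∃ λ r → ⟨ a , b ⟩ *ʳ r ≈ 1# × r *ʳ ⟨ a , b ⟩ ≈ 1#
      ideal          : ∀ b c d → ∃ λ b′ → ⟨ 0F , b ⟩ *ʳ ⟨ c , d ⟩ ≈ ⟨ 0F , b′ ⟩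
      annihilated    : ∀ b → ⟨ 0F , b ⟩ *ʳ ⟨ 0F , 1F ⟩ ≈ 0#
      uniformiser≉0  : ¬ ⟨ 0F , 1F ⟩ ≈ 0#
      joining-rows   : ∀ x t t′ → ∑[ ℓ < 13 ] (I ℓ x * δ (row ℓ x t) (row ℓ x t′)) ≡ 1 + 3 * δ t t′
      incidence      : ∀ ℓ x → I ℓ x ≡ 1 → ∀ t s → slot ℓ x s ≡ row ℓ x t →
        uncurry (OnLine (class ℓ)) (remQuot 3 s) (pointVector x t)

-- From free submodules to the combinatorial model

module FromRing (R : Ring 0ℓ 0ℓ) (⟨_,_⟩ : F₃ → F₃ → Ring.Carrier R) (digits : Ring.Carrier R → F₃ × F₃)
  (isCoordinatisation : Coordinates.IsCoordinatisation R ⟨_,_⟩ digits) where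

  open Coordinates R ⟨_,_⟩ digits
  open IsCoordinatisation isCoordinatisation
  open Ring R
    using (Carrier; _≈_; 0#; 1#; setoid; reflexive; +-cong; +-congˡ; +-congʳ; +-assoc; +-comm; +-identityˡ; +-identityʳ;
           *-cong; *-congˡ; *-congʳ; *-assoc; *-identityˡ; *-identityʳ; distribˡ; distribʳ; zeroˡ; zeroʳ)
    renaming (_+_ to _+ʳ_; _*_ to _*ʳ_; refl to ≈-refl; sym to ≈-sym; trans to ≈-trans)
  open RightModule (PHG₂.R³ R)
    using (Carrierᴹ; _≈ᴹ_; _+ᴹ_; _*ᵣ_; 0ᴹ; ≈ᴹ-sym; ≈ᴹ-trans; *ᵣ-congʳ; *ᵣ-congˡ; *ᵣ-assoc; *ᵣ-identityʳ; +ᴹ-identityʳ)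
  open PHG₂ R using (Point; Line; _≈ᴾ_; _∈ᴸ_)

  plane : HjelmslevPlane 13
  plane = record
    { classes       = refl
    ; I             = I
    ; slot          = slot
    ; row           = row
    ; I-binary      = λ ℓ x → 𝟙-binary (incident? ℓ x)
    ; line-size     = line-size
    ; joining-lines = joining-lines
    ; slot-size     = slot-size
    ; slots-meet    = slots-meet
    ; slots-avoid   = slots-avoid
    ; joining-rows  = joining-rows
    }

  arrange-cong : ∀ c {x y} → x ≈ᴹ y → arrange c x ≈ᴹ arrange c y
  arrange-cong (finite _ _) (p , q , r) = p , q , r
  arrange-cong (infinite _) (p , q , r) = q , p , r
  arrange-cong pole         (p , q , r) = r , p , q

  place-cong : ∀ c {x y} → x ≈ᴹ y → place c x ≈ᴹ place c y
  place-cong (finite _ _) (p , q , r) = p , q , r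
  place-cong (infinite _) (p , q , r) = q , p , r
  place-cong pole         (p , q , r) = q , r , p

  place-arrange : ∀ c (x : Carrierᴹ) → place c (arrange c x) ≡ x
  place-arrange (finite _ _) _ = refl
  place-arrange (infinite _) _ = refl
  place-arrange pole         _ = refl

  arrange-place : ∀ c (x : Carrierᴹ) → arrange c (place c x) ≡ x
  arrange-place (finite _ _) _ = refl
  arrange-place (infinite _) _ = refl
  arrange-place pole         _ = refl

  arrange-+ : ∀ c x y → arrange c (x +ᴹ y) ≡ arrange c x +ᴹ arrange c y
  arrange-+ (finite _ _) _ _ = refl
  arrange-+ (infinite _) _ _ = refl
  arrange-+ pole         _ _ = refl

  arrange-*ᵣ : ∀ c x r → arrange c (x *ᵣ r) ≡ arrange c x *ᵣ r
  arrange-*ᵣ (finite _ _) _ _ = refl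
  arrange-*ᵣ (infinite _) _ _ = refl
  arrange-*ᵣ pole         _ _ = refl

  arrange-0 : ∀ c → arrange c 0ᴹ ≡ 0ᴹ
  arrange-0 (finite _ _) = refl
  arrange-0 (infinite _) = refl
  arrange-0 pole         = refl

  -- Lines as graphs of linear forms

  module Graph (c : PG) (A B : Carrier) where

    Solves : Carrierᴹ → Set
    Solves (z₀ , z₁ , z₂) = z₀ ≈ A *ʳ z₁ +ʳ B *ʳ z₂

    Solves-≈ : ∀ {x y} → x ≈ᴹ y → Solves x → Solves y
    Solves-≈ (p , q , r) x-solves = ≈-trans (≈-sym p) (≈-trans x-solves (+-cong (*-congˡ q) (*-congˡ r)))

    Solves-0 : Solves 0ᴹ
    Solves-0 = ≈-sym (≈-trans (+-cong (zeroʳ A) (zeroʳ B)) (+-identityˡ 0#))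

    Solves-+ : ∀ {x y} → Solves x → Solves y → Solves (x +ᴹ y)
    Solves-+ {_ , x₁ , x₂} {_ , y₁ , y₂} x-solves y-solves = begin
      _ +ʳ _                                        ≈⟨ +-cong x-solves y-solves ⟩
      (A *ʳ x₁ +ʳ B *ʳ x₂) +ʳ (A *ʳ y₁ +ʳ B *ʳ y₂)        ≈⟨ +-assoc _ _ _ ⟩
      A *ʳ x₁ +ʳ (B *ʳ x₂ +ʳ (A *ʳ y₁ +ʳ B *ʳ y₂))        ≈⟨ +-congˡ (+-assoc _ _ _) ⟨
      A *ʳ x₁ +ʳ ((B *ʳ x₂ +ʳ A *ʳ y₁) +ʳ B *ʳ y₂)        ≈⟨ +-congˡ (+-congʳ (+-comm _ _)) ⟩
      A *ʳ x₁ +ʳ ((A *ʳ y₁ +ʳ B *ʳ x₂) +ʳ B *ʳ y₂)        ≈⟨ +-congˡ (+-assoc _ _ _) ⟩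
      A *ʳ x₁ +ʳ (A *ʳ y₁ +ʳ (B *ʳ x₂ +ʳ B *ʳ y₂))        ≈⟨ +-assoc _ _ _ ⟨
      (A *ʳ x₁ +ʳ A *ʳ y₁) +ʳ (B *ʳ x₂ +ʳ B *ʳ y₂)        ≈⟨ +-cong (distribˡ A x₁ y₁) (distribˡ B x₂ y₂) ⟨
      A *ʳ (x₁ +ʳ y₁) +ʳ B *ʳ (x₂ +ʳ y₂)                ∎
      where open SetoidReasoning setoid

    -- The coefficients stand on the left and scalars act on the right, so associativity suffices
    -- without commutativity.
    Solves-*ᵣ : ∀ {x} r → Solves x → Solves (x *ᵣ r)
    Solves-*ᵣ {_ , x₁ , x₂} r x-solves = ≈-trans (*-congʳ x-solves)
      (≈-trans (distribʳ r _ _) (+-cong (*-assoc A x₁ r) (*-assoc B x₂ r)))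

    submodule : Submodule (PHG₂.R³ R)
    submodule = record
      { member    = Solves ∘ arrange c
      ; member-≈  = λ x≈y → Solves-≈ (arrange-cong c x≈y)
      ; 0-closed  = subst Solves (sym (arrange-0 c)) Solves-0
      ; +-closed  = λ {x} {y} p q → subst Solves (sym (arrange-+ c x y)) (Solves-+ {arrange c x} {arrange c y} p q)
      ; *ᵣ-closed = λ {x} r p → subst Solves (sym (arrange-*ᵣ c x r)) (Solves-*ᵣ {arrange c x} r p)
      }

    basis : Fin 2 → Carrierᴹ
    basis 0F = place c (A , 1# , 0#)
    basis 1F = place c (B , 0# , 1#)

    -- The last two arranged coordinates of a combination are its coefficients, which yields both
    -- independence and spanning.
    arrange-combination : ∀ r → arrange c (combination (PHG₂.R³ R) basis r) ≈ᴹ (A *ʳ r 0F +ʳ B *ʳ r 1F , r 0F , r 1F)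
    arrange-combination r
      rewrite arrange-+ c (basis 0F *ᵣ r 0F) (basis 1F *ᵣ r 1F +ᴹ 0ᴹ) | arrange-+ c (basis 1F *ᵣ r 1F) 0ᴹ | arrange-0 c
        | arrange-*ᵣ c (basis 0F) (r 0F) | arrange-*ᵣ c (basis 1F) (r 1F)
        | arrange-place c (A , 1# , 0#) | arrange-place c (B , 0# , 1#)
      = +-congˡ (+-identityʳ _)
      , ≈-trans (+-cong (*-identityˡ _) (≈-trans (+-identityʳ _) (zeroˡ _))) (+-identityʳ _)
      , ≈-trans (+-cong (zeroˡ _) (≈-trans (+-identityʳ _) (*-identityˡ _))) (+-identityˡ _)

    arrange-reflects : ∀ {x y} → arrange c x ≈ᴹ arrange c y → x ≈ᴹ y
    arrange-reflects {x} {y} eq = subst₂ _≈ᴹ_ (place-arrange c x) (place-arrange c y) (place-cong c eq)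

    isBasis : IsBasis (PHG₂.R³ R) submodule basis
    isBasis = record
      { members     = λ where
          0F → subst Solves (sym (arrange-place c _))
            (≈-sym (≈-trans (+-cong (*-identityʳ A) (zeroʳ B)) (+-identityʳ A)))
          1F → subst Solves (sym (arrange-place c _))
            (≈-sym (≈-trans (+-cong (zeroʳ A) (*-identityʳ B)) (+-identityˡ B)))
      ; independent = λ r comb≈0 →
          let _ , r₀≈0 , r₁≈0 = ≈ᴹ-trans (≈ᴹ-sym (arrange-combination r))
                (subst (arrange c (combination (PHG₂.R³ R) basis r) ≈ᴹ_) (arrange-0 c) (arrange-cong c comb≈0))
          in λ { 0F → r₀≈0 ; 1F → r₁≈0 }
      ; spanning    = λ {x} x-solves →
          let _ , z₁ , z₂ = arrange c x ; r = z₁ Vector.∷ z₂ Vector.∷ Vector.[]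
          in r , arrange-reflects (≈ᴹ-trans (x-solves , ≈-refl , ≈-refl) (≈ᴹ-sym (arrange-combination r)))
      }

    line : Line
    line = submodule , basis , isBasis

  planeLine : Fin 13 → Fin 9 → Line
  planeLine ℓ s =
    let a , b = parameters (class ℓ) ; s₁ , s₂ = remQuot 3 s
    in Graph.line (class ℓ) ⟨ a , s₁ ⟩ ⟨ b , s₂ ⟩

  -- Normal forms of points

  Generates : Carrierᴹ → Point → Set
  Generates g (P , _) = Submodule.member P g × (∀ {x} → Submodule.member P x → ∃ λ r → x ≈ᴹ g *ᵣ r)

  pointVector-index : ∀ c t₁ t₂ → pointVector (index c) (combine t₁ t₂) ≡ vector c t₁ t₂
  pointVector-index c t₁ t₂ = cong₂ (λ d → uncurry (vector d)) (class-index c) (remQuot-combine t₁ t₂)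

  Normal : Carrierᴹ → Set
  Normal g = ∃₂ λ x t → ∃₂ λ r r′ → pointVector x t ≈ᴹ g *ᵣ r × g ≈ᴹ pointVector x t *ᵣ r′

  -- A free generator has a unit coordinate, since it is not annihilated by the uniformiser;
  -- dividing by the first unit coordinate yields the normal form.
  normalise : ∀ g → (∀ r → g *ᵣ r ≈ᴹ 0ᴹ → r ≈ 0#) → Normal g
  normalise g@(g₀ , g₁ , g₂) free =
    by-units (proj₁ (digits g₀) ≟ 0F) (proj₁ (digits g₁) ≟ 0F) (proj₁ (digits g₂) ≟ 0F)
    where
    Unit : Carrier → Set
    Unit h = ∃ λ r → h *ʳ r ≈ 1# × r *ʳ h ≈ 1#

    unit-coordinate : ∀ {h} → proj₁ (digits h) ≢ 0F → Unit h
    unit-coordinate {h} d≢0 =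
      let r , hr≈1 , rh≈1 = unit _ _ d≢0
      in r , ≈-trans (*-congʳ (digits-correct h)) hr≈1 , ≈-trans (*-congˡ (digits-correct h)) rh≈1

    radical : ∀ {h} → proj₁ (digits h) ≡ 0F → ∃ λ b → h ≈ ⟨ 0F , b ⟩
    radical {h} d≡0 = proj₂ (digits h) ,
      ≈-trans (digits-correct h) (reflexive (cong (λ a → ⟨ a , proj₂ (digits h) ⟩) d≡0))

    radical-* : ∀ {h} r → proj₁ (digits h) ≡ 0F → ∃ λ b → ⟨ 0F , b ⟩ ≈ h *ʳ r
    radical-* {h} r d≡0 =
      let b , h≈ = radical d≡0 ; b′ , eq = ideal b (proj₁ (digits r)) (proj₂ (digits r))
      in b′ , ≈-sym (≈-trans (*-cong h≈ (digits-correct r)) eq)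

    normal : ∀ c t₁ t₂ {h} → ((r , _) : Unit h) → vector c t₁ t₂ ≈ᴹ g *ᵣ r → Normal g
    normal c t₁ t₂ {h} (r , hr≈1 , rh≈1) eq = index c , combine t₁ t₂ , r , h , eq′ , (begin
      g                                              ≈⟨ *ᵣ-identityʳ g ⟨
      g *ᵣ 1#                                        ≈⟨ *ᵣ-congˡ rh≈1 ⟨
      g *ᵣ (r *ʳ h)                                  ≈⟨ *ᵣ-assoc g r h ⟨
      (g *ᵣ r) *ᵣ h                                  ≈⟨ *ᵣ-congʳ eq′ ⟨
      pointVector (index c) (combine t₁ t₂) *ᵣ h     ∎)
      where
      open SetoidReasoning (RightModule.≈ᴹ-setoid (PHG₂.R³ R))
      eq′ : pointVector (index c) (combine t₁ t₂) ≈ᴹ g *ᵣ r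
      eq′ = subst (_≈ᴹ g *ᵣ r) (sym (pointVector-index c t₁ t₂)) eq

    by-units : Dec (proj₁ (digits g₀) ≡ 0F) → Dec (proj₁ (digits g₁) ≡ 0F) → Dec (proj₁ (digits g₂) ≡ 0F) → Normal g
    by-units (no g₀-unit) _ _ =
      let h@(r , g₀r≈1 , _) = unit-coordinate g₀-unit
          a , t₁ = digits (g₁ *ʳ r) ; b , t₂ = digits (g₂ *ʳ r)
      in normal (finite a b) t₁ t₂ h
        (≈-sym g₀r≈1 , ≈-sym (digits-correct (g₁ *ʳ r)) , ≈-sym (digits-correct (g₂ *ʳ r)))
    by-units (yes g₀≡0) (no g₁-unit) _ =
      let h@(r , g₁r≈1 , _) = unit-coordinate g₁-unit
          t₁ , eq = radical-* r g₀≡0 ; b , t₂ = digits (g₂ *ʳ r)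
      in normal (infinite b) t₁ t₂ h (eq , ≈-sym g₁r≈1 , ≈-sym (digits-correct (g₂ *ʳ r)))
    by-units (yes g₀≡0) (yes g₁≡0) (no g₂-unit) =
      let h@(r , g₂r≈1 , _) = unit-coordinate g₂-unit
          t₁ , eq₁ = radical-* r g₀≡0 ; t₂ , eq₂ = radical-* r g₁≡0
      in normal pole t₁ t₂ h (eq₁ , eq₂ , ≈-sym g₂r≈1)
    by-units (yes g₀≡0) (yes g₁≡0) (yes g₂≡0) =
      contradiction (free ⟨ 0F , 1F ⟩ (killed g₀≡0 , killed g₁≡0 , killed g₂≡0)) uniformiser≉0
      where
      killed : ∀ {h} → proj₁ (digits h) ≡ 0F → h *ʳ ⟨ 0F , 1F ⟩ ≈ 0#
      killed d≡0 = let b , h≈ = radical d≡0 in ≈-trans (*-congʳ h≈) (annihilated b)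

  -- Independence says that the basis vector is annihilated only by zero, so `normalise` applies. A
  -- member `g c` of the point is rewritten as `p (r′ c)` with `p` the normalised vector.
  coordinates : ∀ P → ∃₂ λ x t → Generates (pointVector x t) P
  coordinates (P , b , isBasis) =
    let x , t , r , r′ , p≈gr , g≈pr′ = normalise (b 0F) free
    in x , t , member-≈ (≈ᴹ-sym p≈gr) (*ᵣ-closed r (members 0F))
     , λ y∈P → let c , y≈ = spanning y∈P in
         r′ *ʳ c 0F , ≈ᴹ-trans y≈ (≈ᴹ-trans (+ᴹ-identityʳ _) (≈ᴹ-trans (*ᵣ-congʳ g≈pr′) (*ᵣ-assoc _ r′ (c 0F))))
    where
    open Submodule P
    open IsBasis isBasis
    free : ∀ r → b 0F *ᵣ r ≈ᴹ 0ᴹ → r ≈ 0#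
    free r gr≈0 = independent (λ _ → r) (≈ᴹ-trans (+ᴹ-identityʳ _) gr≈0) 0F

  Generates-⊆ : ∀ {g} (P : Point) (N : Submodule (PHG₂.R³ R)) → Generates g P → Submodule.member N g →
    ∀ {x} → Submodule.member (proj₁ P) x → Submodule.member N x
  Generates-⊆ P N (_ , spans) g∈N x∈P =
    let r , x≈gr = spans x∈P in Submodule.member-≈ N (≈ᴹ-sym x≈gr) (Submodule.*ᵣ-closed N r g∈N)

  Generates-≈ᴾ : ∀ {g} P Q → Generates g P → Generates g Q → P ≈ᴾ Q
  Generates-≈ᴾ P Q gP gQ = Generates-⊆ P (proj₁ Q) gP (proj₁ gQ) , Generates-⊆ Q (proj₁ P) gQ (proj₁ gP)

  -- Arc points incident with a line of the model lie on the corresponding free submodule, so they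
  -- form a subset to which the arc bound applies. Equal coordinates mean equal submodules, whence
  -- injectivity.
  planeArc : ∀ {k n} → ProjectiveArc R k n → Arc plane k n
  planeArc {k} {n} arc = record
    { cls       = cls
    ; pos       = pos
    ; injective = λ {i} {j} same-cls same-pos → distinct (Generates-≈ᴾ (point i) (point j) (generates i)
        (subst₂ (λ x t → Generates (pointVector x t) (point j)) (sym same-cls) (sym same-pos) (generates j)))
    ; meets     = λ ℓ s → subst (_≤ n)
        (trans (∣tabulate∣ (on? ℓ s)) (sum-cong-≗ λ i →
          𝟙-× (incident? ℓ (cls i)) (slot ℓ (cls i) s ≟ row ℓ (cls i) (pos i))))
        (meets (planeLine ℓ s) (tabulate (does ∘ on? ℓ s)) (λ {i} i∈ → on-line ℓ s i (∈-tabulate (on? ℓ s) i∈)))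
    }
    where
    open ProjectiveArc arc
    cls : Fin k → Fin 13
    cls i = proj₁ (coordinates (point i))
    pos : Fin k → Fin 9
    pos i = proj₁ (proj₂ (coordinates (point i)))
    generates : ∀ i → Generates (pointVector (cls i) (pos i)) (point i)
    generates i = proj₂ (proj₂ (coordinates (point i)))
    on? : ∀ ℓ s i → Dec _
    on? ℓ s i = incident? ℓ (cls i) ×-dec (slot ℓ (cls i) s ≟ row ℓ (cls i) (pos i))
    on-line : ∀ ℓ s i → _ → point i ∈ᴸ planeLine ℓ s
    on-line ℓ s i (x∈ℓ , same-row) = Generates-⊆ (point i) (proj₁ (planeLine ℓ s)) (generates i)
      (incidence ℓ (cls i) (𝟙-true (incident? ℓ (cls i)) x∈ℓ) (pos i) s same-row)

  arc-size : ∀ {k} → ProjectiveArc R k 7 → k ≤ 62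
  arc-size {k} arc = ℕ.≮⇒≥ λ 63≤k →
    no-arc plane (restrict 63 (k ∸ 63)
      (subst (λ j → Arc plane j 7) (sym (ℕ.m+[n∸m]≡n 63≤k)) (planeArc arc))) refl

  m₇≤62 : (∀ k → m[ 7 , R ]≡ k → k ≤ 62) × ¬ ProjectiveArc R 63 7
  m₇≤62 = (λ k max → arc-size (m[_,_]≡_.attained max)) , λ arc → ℕ.<-irrefl refl (arc-size arc)

-- The two rings

module Z₉ where

  -- With π = 3 this is the number `a + 3 b`; the arguments are swapped because `combine` takes the
  -- high digit first.
  ⟨_,_⟩ : F₃ → F₃ → Fin 9
  ⟨ a , b ⟩ = combine b a

  digits : Fin 9 → F₃ × F₃
  digits r = let b , a = remQuot {3} 3 r in a , b

  open Coordinates ℤ₉ ⟨_,_⟩ digits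

  isCoordinatisation : IsCoordinatisation
  isCoordinatisation = record
    { digits-correct = by-decision (all? λ r → r ≟ uncurry ⟨_,_⟩ (digits r))
    ; unit = by-decision (all? λ a → all? λ b → ¬? (a ≟ 0F) →-dec any? λ r → (_ ≟ _) ×-dec (_ ≟ _))
    ; ideal = by-decision (all? λ b → all? λ c → all? λ d → any? λ b′ → _ ≟ _)
    ; annihilated = by-decision (all? λ b → _ ≟ _)
    ; uniformiser≉0 = λ ()
    ; joining-rows = by-decision (all? λ x → all? λ t → all? λ t′ → _ ℕ.≟ _)
    ; incidence = by-decision (all? λ ℓ → all? λ x → (I ℓ x ℕ.≟ 1) →-dec all? λ t → all? λ s →
        (_ ≟ _) →-dec (_ ≟ _))
    }

module S₃ where

  open Ring 𝕊₃ using (_≈_; 1#) renaming (_*_ to _*ʳ_)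

  _≈?_ : Decidable _≈_
  _≈?_ = ×-decidable _≟_ _≟_

  open Coordinates 𝕊₃ _,_ id

  -- The product of `a + bX` and `a - bX` is the square of `a`, which is 1 for nonzero `a` modulo 3.
  inverse : ∀ a b → a ≢ 0F → (a , b) *ʳ (a , Modular.⊖_ 3 b) ≈ 1# × (a , Modular.⊖_ 3 b) *ʳ (a , b) ≈ 1#
  inverse = by-decision (all? λ a → all? λ b → ¬? (a ≟ 0F) →-dec ((_ ≈? _) ×-dec (_ ≈? _)))

  isCoordinatisation : IsCoordinatisation
  isCoordinatisation = record
    { digits-correct = λ r → Ring.refl 𝕊₃
    ; unit = λ a b a≢0 → (a , Modular.⊖_ 3 b) , inverse a b a≢0
    ; ideal = by-decision (all? λ b → all? λ c → all? λ d → any? λ b′ → _ ≈? _)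
    ; annihilated = by-decision (all? λ b → _ ≈? _)
    ; uniformiser≉0 = λ ()
    ; joining-rows = by-decision (all? λ x → all? λ t → all? λ t′ → _ ℕ.≟ _)
    ; incidence = by-decision (all? λ ℓ → all? λ x → (I ℓ x ℕ.≟ 1) →-dec all? λ t → all? λ s →
        (_ ≟ _) →-dec (_ ≈? _))
    }

theorem4p13 : ((∀ k → m[ 7 , ℤ₉ ]≡ k → k ≤ 62) × ¬ ProjectiveArc ℤ₉ 63 7)
    × ((∀ k → m[ 7 , 𝕊₃ ]≡ k → k ≤ 62) × ¬ ProjectiveArc 𝕊₃ 63 7)
theorem4p13 = FromRing.m₇≤62 ℤ₉ Z₉.⟨_,_⟩ Z₉.digits Z₉.isCoordinatisation
            , FromRing.m₇≤62 𝕊₃ _,_ id S₃.isCoordinatisation
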